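{- Let $Z\subseteq\mathbb N$ be a dense simple set with $0\notin Z$, let $a_0<a_1<a_2<\cdots$ be the elements of $\mathbb N\setminus Z$ in ascending order, and define $x\,\zeta\,y$ iff there is an $n$ with $a_n\le\min\{x,y\}\le\max\{x,y\}<a_{n+1}$. Then $\zeta$ is a positive equivalence relation, there is a confidently learnable $\zeta$-family, and there is no finitely learnable $\zeta$-family.
   Context: A set $Z$ is dense simple if it is recursively enumerable, coinfinite, and the ascending enumeration $a_0<a_1<\cdots$ of its complement grows faster than every recursive function (for every recursive $f$, $a_n>f(n)$ for almost all $n$). A positive equivalence relation is an equivalence relation on $\mathbb{N}$ that is recursively enumerable (as a set of pairs) and has infinitely many equivalence classes. A set is $\zeta$-closed if it is a union of $\zeta$-classes. A $\zeta$-family is an infinite family of $\zeta$-closed sets possessing a uniformly r.e. one-one numbering $B_0,B_1,\dots$ (i.e. $\{\langle k,x\rangle:x\in B_k\}$ is r.e. and $B_i\neq B_j$ for $i\ne j$). $W_0,W_1,\dots$ is a fixed acceptable numbering of the r.e. sets. A text for $L$ is a total $T:\mathbb N\to\mathbb N\cup\{\#\}$ whose range minus $\{\#\}$ is $L$; $T[n]$ is its initial segment of length $n$. A learner is a recursive function $M$ from finite sequences over $\mathbb N\cup\{\#\}$ to $\mathbb N\cup\{?\}$; an output $e$ is interpreted as the hypothesis "the $\zeta$-closure of $W_e$". A family $\mathcal C$ is confidently learnable if some $M$, on every text $T$ for every $L\in\mathcal C$, outputs from some point on a single index whose hypothesis equals $L$, and moreover on every text for every set $L\subseteq\mathbb N$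 the sequence $M(T[n])$ converges; finitely learnable if some $M$, on every text $T$ for every $L\in\mathcal C$, has an $n$ with $M(T[m])=?$ for all $m<n$, $M(T[j])=M(T[n])$ for all $j\ge n$, and the hypothesis of $M(T[n])$ equal to $L$. -}

module Defs where

open import Data.Nat using (ℕ; zero; suc; _+_; _≤_; _<_; _⊔_; _⊓_)
open import Data.Nat.DivMod using (_/_; _%_)
open import Data.Product using (Σ; _×_; _,_; proj₁; proj₂; ∃)
open import Data.Maybe using (Maybe; just; nothing)
open import Data.List using (List; []; _∷_; _++_)
open import Data.List.Relation.Unary.All using (All)
open import Relation.Binary.PropositionalEquality using (_≡_; _≢_)
open import Relation.Binary.Structures using (IsEquivalence)
open import Relation.Nullary using (¬_)

tri : ℕ → ℕ
tri zero    = zero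
tri (suc k) = suc k + tri k

pair : ℕ → ℕ → ℕ
pair x y = tri (x + y) + y

-- unpair enumerates ℕ×ℕ in the Cantor order: inverse of pair
unpair : ℕ → ℕ × ℕ
unpair zero = (0 , 0)
unpair (suc n) with unpair n
... | (zero  , y) = (suc y , 0)
... | (suc x , y) = (x , suc y)

π₁ π₂ : ℕ → ℕ
π₁ z = proj₁ (unpair z)
π₂ z = proj₂ (unpair z)

-- A model of computation: unary μ-recursive functions over ℕ
-- (with pairing), a Turing-complete programming system.

data Code : Set where
  Zc Sc Ic Lc Rc : Code
  Comp : Code → Code → Code
  Pair : Code → Code → Code
  Rec  : Code → Code → Code
  Min  : Code → Code

data Ev : Code → ℕ → ℕ → Set where
  ev-Z : ∀ {x} → Ev Zc x 0
  ev-S : ∀ {x} → Ev Sc x (suc x)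
  ev-I : ∀ {x} → Ev Ic x x
  ev-L : ∀ {x} → Ev Lc x (π₁ x)
  ev-R : ∀ {x} → Ev Rc x (π₂ x)
  ev-Comp : ∀ {f g x y z} → Ev g x y → Ev f y z → Ev (Comp f g) x z
  ev-Pair : ∀ {f g x y z} → Ev f x y → Ev g x z → Ev (Pair f g) x (pair y z)
  ev-Rec0 : ∀ {f g x y} → Ev f x y → Ev (Rec f g) (pair x 0) y
  ev-RecS : ∀ {f g x n y z} → Ev (Rec f g) (pair x n) y →
            Ev g (pair x (pair n y)) z → Ev (Rec f g) (pair x (suc n)) z
  ev-Min : ∀ {f x n} → Ev f (pair x n) 0 →
           (∀ m → m < n → Σ ℕ λ k → Ev f (pair x m) (suc k)) →
           Ev (Min f) x n

-- Gödel numbering of programs (surjective; fuel argument only for termination)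
build : ℕ → (ℕ → Code) → ℕ → Code
build 0 r q = Zc
build 1 r q = Sc
build 2 r q = Ic
build 3 r q = Lc
build 4 r q = Rc
build 5 r q = Comp (r (π₁ q)) (r (π₂ q))
build 6 r q = Pair (r (π₁ q)) (r (π₂ q))
build 7 r q = Rec (r (π₁ q)) (r (π₂ q))
build 8 r q = Min (r q)
build _ r q = Zc

decodeF : ℕ → ℕ → Code
decodeF zero    n = Zc
decodeF (suc f) n = build (n % 9) (decodeF f) (n / 9)

decode : ℕ → Code
decode n = decodeF (suc n) n

φ : ℕ → ℕ → ℕ → Set
φ e x y = Ev (decode e) x y

W : ℕ → ℕ → Set
W e x = ∃ λ y → φ e x y

_≐_ : (ℕ → Set) → (ℕ → Set) → Set
A ≐ B = ∀ x → (A x → B x) × (B x → A x)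

RE : (ℕ → Set) → Set
RE A = ∃ λ e → A ≐ W e

RERel : (ℕ → ℕ → Set) → Set
RERel R = RE (λ z → R (π₁ z) (π₂ z))

Recursive : (ℕ → ℕ) → Set
Recursive f = ∃ λ e → ∀ x → φ e x (f x)

AscendingEnumOfComplement : (ℕ → Set) → (ℕ → ℕ) → Set
AscendingEnumOfComplement Z a =
  (∀ n → a n < a (suc n)) × (∀ x → (¬ Z x → ∃ λ n → a n ≡ x) × ((∃ λ n → a n ≡ x) → ¬ Z x))

-- dense simple (coinfinity is witnessed by the enumeration a)
DenseSimple : (ℕ → Set) → (ℕ → ℕ) → Set
DenseSimple Z a =
  RE Z × AscendingEnumOfComplement Z a ×
  (∀ f → Recursive f → ∃ λ N → ∀ n → N ≤ n → f n < a n)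

zeta : (ℕ → ℕ) → ℕ → ℕ → Set
zeta a x y = ∃ λ n → (a n ≤ x ⊓ y) × (x ⊓ y ≤ x ⊔ y) × (x ⊔ y < a (suc n))

InfinitelyManyClasses : (ℕ → ℕ → Set) → Set
InfinitelyManyClasses R = ∀ (xs : List ℕ) → ∃ λ x → All (λ y → ¬ R x y) xs

PositiveEquivalence : (ℕ → ℕ → Set) → Set
PositiveEquivalence R = IsEquivalence R × RERel R × InfinitelyManyClasses R

Closed : (ℕ → ℕ → Set) → (ℕ → Set) → Set
Closed R A = ∀ x y → R x y → A x → A y

IsFamily : (ℕ → ℕ → Set) → (ℕ → ℕ → Set) → Set
IsFamily R B =
  (∀ k → Closed R (B k)) ×
  RERel B ×
  (∀ i j → i ≢ j → ¬ (B i ≐ B j))              -- one-one (hence infinite)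

-- # is nothing
Text : Set
Text = ℕ → Maybe ℕ

IsTextFor : (ℕ → Set) → Text → Set
IsTextFor L T = ∀ x → (L x → ∃ λ n → T n ≡ just x) × ((∃ λ n → T n ≡ just x) → L x)

initSeg : Text → ℕ → List (Maybe ℕ)
initSeg T zero    = []
initSeg T (suc n) = initSeg T n ++ (T n ∷ [])

-- coding of finite sequences over ℕ ∪ {#} and of outputs in ℕ ∪ {?}
codeM : Maybe ℕ → ℕ
codeM nothing  = 0
codeM (just x) = suc x

codeSeq : List (Maybe ℕ) → ℕ
codeSeq []      = 0
codeSeq (m ∷ s) = suc (pair (codeM m) (codeSeq s))

-- a learner (output nothing = ?) is recursive
RecursiveLearner : (List (Maybe ℕ) → Maybe ℕ) → Set
RecursiveLearner M = ∃ λ e → ∀ σ → φ e (codeSeq σ) (codeM (M σ))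

Hyp : (ℕ → ℕ → Set) → ℕ → ℕ → Set
Hyp R e x = ∃ λ y → R x y × W e y

ConfidentlyLearns : (ℕ → ℕ → Set) → (List (Maybe ℕ) → Maybe ℕ) → (ℕ → ℕ → Set) → Set₁
ConfidentlyLearns R M B =
  (∀ k T → IsTextFor (B k) T →
     ∃ λ n → ∃ λ e → (∀ m → n ≤ m → M (initSeg T m) ≡ just e) × (Hyp R e ≐ B k)) ×
  (∀ (L : ℕ → Set) T → IsTextFor L T →
     ∃ λ n → ∃ λ (o : Maybe ℕ) → ∀ m → n ≤ m → M (initSeg T m) ≡ o)

FinitelyLearns : (ℕ → ℕ → Set) → (List (Maybe ℕ) → Maybe ℕ) → (ℕ → ℕ → Set) → Set
FinitelyLearns R M B =
  ∀ k T → IsTextFor (B k) T →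
    ∃ λ n → ∃ λ e →
      (∀ m → m < n → M (initSeg T m) ≡ nothing) ×
      (∀ j → n ≤ j → M (initSeg T j) ≡ just e) ×
      (Hyp R e ≐ B k)

{-# OPTIONS --safe #-}
module Submission where

-- Class indices x ↦ cls x are limits, from above, of uniformly computable stagewise guesses. The confidently
-- learnable family is B k = the class of k and the k classes following it: the number k + 1 of classes identifies
-- k, and on any data a learner can estimate the number of classes between the least and the greatest datum; since k
-- must lie in the least class, data spreading over unboundedly many classes refute every hypothesis in the end.
--
-- If M learnt a family B finitely, the time u k it needs on an effective text for B k would be computable in k, so
-- by density Σ_{i ≤ 2^n} u i < a n for some n. The data used for B 0, …, B (2^n) then meet only the first n
-- classes, so those for two different B i and B j meet the same classes. B j thus contains the data on which M
-- settles for B i, and M must give the same answer on a text for B j beginning with them.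

open import Defs
open import Data.Empty using (⊥)
open import Data.Nat
open import Data.Nat.Divisibility using (divides-refl)
open import Data.Nat.DivMod
open import Data.Nat.ListAction using (sum)
open import Data.Nat.Properties
open import Data.Fin using (Fin; toℕ; fromℕ<; funToFin; finToFun) renaming (zero to fzero; suc to fsuc)
open import Data.Fin.Properties using (pigeonhole; finToFun-funToFin; toℕ<n; toℕ-fromℕ<)
open import Data.Maybe using (Maybe; just; nothing)
open import Data.List using (List; []; _∷_; _++_; length; foldl)
open import Data.List.Properties using (++-assoc; ++-identityʳ; foldl-++)
open import Data.List.Relation.Unary.All using (All; []; _∷_) renaming (map to mapAll)
open import Data.Product using (_×_; _,_; proj₁; proj₂; ∃)
open import Data.Sum using (_⊎_; inj₁; inj₂)
open import Function using (case_of_; flip)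
open import Relation.Binary.PropositionalEquality
open import Relation.Binary.Structures using (IsEquivalence)
open import Relation.Nullary using (¬_; yes; no; contradiction)
open import Level using (0ℓ)
open import Axiom.ExcludedMiddle using (ExcludedMiddle)

-- Pairing and Gödel numbers

pair-suc : ∀ x y → pair x (suc y) ≡ suc (pair (suc x) y)
pair-suc x y rewrite +-suc x y = +-suc _ y

pair-0 : ∀ x → pair (suc x) 0 ≡ suc (pair 0 x)
pair-0 x rewrite +-identityʳ x | +-identityʳ (x + tri x) = cong suc (+-comm x (tri x))

unpair-suc₀ : ∀ n {y} → unpair n ≡ (0 , y) → unpair (suc n) ≡ (suc y , 0)
unpair-suc₀ n eq rewrite eq = refl

unpair-suc₁ : ∀ n {x y} → unpair n ≡ (suc x , y) → unpair (suc n) ≡ (x , suc y)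
unpair-suc₁ n eq rewrite eq = refl

-- `unpair` climbs each diagonal `x + y = n` by raising `y`, so the induction lowers `y` along the
-- diagonal and drops to the previous one at `y = 0`.
unpair-pair : ∀ x y → unpair (pair x y) ≡ (x , y)
unpair-pair x y = go (x + y) x y refl
  where
  go : ∀ n x y → x + y ≡ n → unpair (pair x y) ≡ (x , y)
  go n zero zero eq = refl
  go zero (suc x) zero ()
  go (suc n) (suc x) zero eq = trans (cong unpair (pair-0 x))
    (unpair-suc₀ (pair 0 x) (go n 0 x (trans (sym (+-identityʳ x)) (suc-injective eq))))
  go n x (suc y) eq = trans (cong unpair (pair-suc x y))
    (unpair-suc₁ (pair (suc x) y) (go n (suc x) y (trans (sym (+-suc x y)) eq)))

π₁-pair : ∀ x y → π₁ (pair x y) ≡ x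
π₁-pair x y = cong proj₁ (unpair-pair x y)

π₂-pair : ∀ x y → π₂ (pair x y) ≡ y
π₂-pair x y = cong proj₂ (unpair-pair x y)

pair-π : ∀ z → pair (π₁ z) (π₂ z) ≡ z
pair-π zero = refl
pair-π (suc z) with unpair z | pair-π z
... | zero  , y | eq = trans (pair-0 y) (cong suc eq)
... | suc x , y | eq = trans (pair-suc x y) (cong suc eq)

m≤tri : ∀ m → m ≤ tri m
m≤tri zero    = z≤n
m≤tri (suc m) = m≤m+n (suc m) (tri m)

m≤pair : ∀ m n → m ≤ pair m n
m≤pair m n = ≤-trans (m≤m+n m n) (≤-trans (m≤tri (m + n)) (m≤m+n _ n))

n≤pair : ∀ m n → n ≤ pair m n
n≤pair m n = m≤n+m n (tri (m + n))

encode : Code → ℕ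
encode Zc         = 0
encode Sc         = 1
encode Ic         = 2
encode Lc         = 3
encode Rc         = 4
encode (Comp f g) = 5 + pair (encode f) (encode g) * 9
encode (Pair f g) = 6 + pair (encode f) (encode g) * 9
encode (Rec f g)  = 7 + pair (encode f) (encode g) * 9
encode (Min f)    = 8 + encode f * 9

-- The induction is over every fuel above the code, because subprograms are decoded with the fuel
-- left by their parent. The tag of a compound program is positive, so the quotient by 9 is strictly
-- below the code.
decode-encode : ∀ c → decode (encode c) ≡ c
decode-encode c = go c _ ≤-refl
  where
  node : ∀ r q f → r < 9 → decodeF (suc f) (r + q * 9) ≡ build r (decodeF f) q
  node r q f r<9 = cong₂ (λ i j → build i (decodeF f) j)
    (trans ([m+kn]%n≡m%n r q 9) (m<n⇒m%n≡m r<9))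
    (trans (+-distrib-/-∣ʳ r (divides-refl q)) (cong₂ _+_ (m<n⇒m/n≡0 r<9) (m*n/n≡m q 9)))
  smaller : ∀ r q {f} → suc r + q * 9 < suc f → q < f
  smaller r q (s≤s p) = ≤-trans (s≤s (≤-trans (m≤m*n q 9) (m≤n+m _ r))) p
  go : ∀ c f → encode c < f → decodeF f (encode c) ≡ c
  go₂ : ∀ c d {f} → pair (encode c) (encode d) < f →
        decodeF f (π₁ (pair (encode c) (encode d))) ≡ c × decodeF f (π₂ (pair (encode c) (encode d))) ≡ d
  go Zc (suc f) p = refl
  go Sc (suc f) p = refl
  go Ic (suc f) p = refl
  go Lc (suc f) p = refl
  go Rc (suc f) p = refl
  go (Comp c d) (suc f) p = trans (node 5 (pair (encode c) (encode d)) f (m≤m+n 6 3)) (cong₂ Comp (proj₁ ih) (proj₂ ih))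
    where ih = go₂ c d (smaller 4 _ p)
  go (Pair c d) (suc f) p = trans (node 6 (pair (encode c) (encode d)) f (m≤m+n 7 2)) (cong₂ Pair (proj₁ ih) (proj₂ ih))
    where ih = go₂ c d (smaller 5 _ p)
  go (Rec c d) (suc f) p = trans (node 7 (pair (encode c) (encode d)) f (m≤m+n 8 1)) (cong₂ Rec (proj₁ ih) (proj₂ ih))
    where ih = go₂ c d (smaller 6 _ p)
  go (Min c) (suc f) p = trans (node 8 _ f ≤-refl) (cong Min (go c f (smaller 7 _ p)))
  go₂ c d {f} p rewrite unpair-pair (encode c) (encode d) =
    go c f (≤-<-trans (m≤pair _ _) p) , go d f (≤-<-trans (n≤pair (encode c) _) p)

-- Total computable functions

-- The program is kept instead of its number, so that closure properties are built from the syntax;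
-- numbers enter only where a statement demands an index.
record Computable (f : ℕ → ℕ) : Set where
  constructor mkC
  field
    code : Code
    eval : ∀ x → Ev code x (f x)
open Computable

Computable₂ : (ℕ → ℕ → ℕ) → Set
Computable₂ f = Computable (λ w → f (π₁ w) (π₂ w))

Computable₃ : (ℕ → ℕ → ℕ → ℕ) → Set
Computable₃ f = Computable (λ w → f (π₁ w) (π₁ (π₂ w)) (π₂ (π₂ w)))

primRec : ℕ → (ℕ → ℕ → ℕ) → ℕ → ℕ
primRec z s zero    = z
primRec z s (suc n) = s n (primRec z s n)

natCase : ℕ → ℕ → (ℕ → ℕ) → ℕ
natCase zero    z s = z
natCase (suc n) z s = s n

module _ where
  private variable
    f g : ℕ → ℕ

  ext : (∀ x → f x ≡ g x) → Computable f → Computable g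
  ext f≗g F = mkC (code F) λ x → subst (Ev (code F) x) (f≗g x) (eval F x)

  -- Abstract because for a concrete code the type checker would evaluate the index as an astronomically large numeral.
  abstract
    recursive : Computable f → Recursive f
    recursive F = encode (code F) , λ x → subst (λ c → Ev c x _) (sym (decode-encode (code F))) (eval F x)

  idᶜ : Computable (λ x → x)
  idᶜ = mkC Ic λ x → ev-I

  π₁ᶜ : Computable π₁
  π₁ᶜ = mkC Lc λ x → ev-L

  π₂ᶜ : Computable π₂
  π₂ᶜ = mkC Rc λ x → ev-R

  infixr 9 _∘ᶜ_
  _∘ᶜ_ : Computable f → Computable g → Computable (λ x → f (g x))
  F ∘ᶜ G = mkC (Comp (code F) (code G)) λ x → ev-Comp (eval G x) (eval F _)

  sucᶜ : Computable f → Computable (λ x → suc (f x))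
  sucᶜ F = mkC Sc (λ x → ev-S) ∘ᶜ F

  constCode : ℕ → Code
  constCode zero    = Zc
  constCode (suc n) = Comp Sc (constCode n)

  constᶜ : ∀ n → Computable (λ _ → n)
  constᶜ n = mkC (constCode n) (go n)
    where
    go : ∀ n x → Ev (constCode n) x n
    go zero    x = ev-Z
    go (suc n) x = ev-Comp (go n x) ev-S

  pairᶜ : Computable f → Computable g → Computable (λ x → pair (f x) (g x))
  pairᶜ F G = mkC (Pair (code F) (code G)) λ x → ev-Pair (eval F x) (eval G x)

  ap₂ : ∀ {k : ℕ → ℕ → ℕ} → Computable₂ k → Computable f → Computable g → Computable (λ x → k (f x) (g x))
  ap₂ {f = f} {g} {k} K F G =
    ext (λ x → cong₂ k (π₁-pair (f x) (g x)) (π₂-pair (f x) (g x))) (K ∘ᶜ pairᶜ F G)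

  primRecᶜ : ∀ {s : ℕ → ℕ → ℕ → ℕ} → Computable f → Computable₃ s → Computable g →
             Computable (λ x → primRec (f x) (s x) (g x))
  primRecᶜ {f = f} {s = s} F S G =
    ap₂ {k = λ x n → primRec (f x) (s x) n}
      (mkC R λ w → subst (λ v → Ev R v (primRec (f (π₁ w)) (s (π₁ w)) (π₂ w))) (pair-π w) (go (π₁ w) (π₂ w)))
      idᶜ G
    where
    R = Rec (code F) (code S)
    go : ∀ x n → Ev R (pair x n) (primRec (f x) (s x) n)
    go x zero    = ev-Rec0 (eval F x)
    go x (suc n) = ev-RecS {x = x} {n = n} (go x n)
      (subst (Ev (code S) (pair x (pair n r))) eq (eval S (pair x (pair n r))))
      where
      r = primRec (f x) (s x) n
      eq : s (π₁ (pair x (pair n r))) (π₁ (π₂ (pair x (pair n r)))) (π₂ (π₂ (pair x (pair n r)))) ≡ s x n r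
      eq rewrite unpair-pair x (pair n r) | unpair-pair n r = refl

natCaseᶜ : ∀ {f g : ℕ → ℕ} {s : ℕ → ℕ → ℕ} → Computable f → Computable g → Computable₂ s →
           Computable (λ x → natCase (f x) (g x) (s x))
natCaseᶜ {f} {g} {s} F G S =
  ext (λ x → eq x (f x)) (primRecᶜ {s = λ x n _ → s x n} G (ap₂ {k = s} S π₁ᶜ (π₁ᶜ ∘ᶜ π₂ᶜ)) F)
  where
  eq : ∀ x n → primRec (g x) (λ n _ → s x n) n ≡ natCase n (g x) (s x)
  eq x zero    = refl
  eq x (suc n) = refl

predᶜ : ∀ {f : ℕ → ℕ} → Computable f → Computable (λ x → pred (f x))
predᶜ {f} F = ext (λ x → eq (f x)) (natCaseᶜ {s = λ _ n → n} F (constᶜ 0) π₂ᶜ)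
  where
  eq : ∀ n → natCase n 0 (λ n → n) ≡ pred n
  eq zero    = refl
  eq (suc n) = refl

infixl 6 _+ᶜ_ _∸ᶜ_

_+ᶜ_ : ∀ {f g : ℕ → ℕ} → Computable f → Computable g → Computable (λ x → f x + g x)
_+ᶜ_ {f} {g} F G = ext (λ x → eq (g x) (f x)) (primRecᶜ {s = λ _ _ r → suc r} G (sucᶜ (π₂ᶜ ∘ᶜ π₂ᶜ)) F)
  where
  eq : ∀ n m → primRec n (λ _ → suc) m ≡ m + n
  eq n zero    = refl
  eq n (suc m) = cong suc (eq n m)

_∸ᶜ_ : ∀ {f g : ℕ → ℕ} → Computable f → Computable g → Computable (λ x → f x ∸ g x)
_∸ᶜ_ {f} {g} F G = ext (λ x → eq (f x) (g x)) (primRecᶜ {s = λ _ _ r → pred r} F (predᶜ (π₂ᶜ ∘ᶜ π₂ᶜ)) G)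
  where
  eq : ∀ m n → primRec m (λ _ → pred) n ≡ m ∸ n
  eq m zero    = refl
  eq m (suc n) = trans (cong pred (eq m n)) (pred[m∸n]≡m∸[1+n] m n)

-- Stagewise evaluation of programs

minStep : (ℕ → ℕ) → ℕ → ℕ → ℕ
minStep v t st = natCase st (natCase (v t) 1 (λ w → natCase w (2 + t) (λ _ → 0))) suc

-- The state of a search for a zero of a partial function v (0: undefined, suc y: value y):
-- 0 still searching, 1 hit an undefined value, 2 + n found the zero n.
minSearch : (ℕ → ℕ) → ℕ → ℕ
minSearch v = primRec 0 (minStep v)

-- run c s x = suc y if c yields y on input x with all searches bounded by s, and 0 if it yields nothing.
run : Code → ℕ → ℕ → ℕ
runRec : Code → Code → ℕ → ℕ → ℕ → ℕ
run Zc         s x = 1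
run Sc         s x = 2 + x
run Ic         s x = suc x
run Lc         s x = suc (π₁ x)
run Rc         s x = suc (π₂ x)
run (Comp f g) s x = natCase (run g s x) 0 (run f s)
run (Pair f g) s x = natCase (run f s x) 0 λ y → natCase (run g s x) 0 λ z → suc (pair y z)
run (Rec f g)  s x = runRec f g s (π₁ x) (π₂ x)
run (Min f)    s x = pred (minSearch (λ n → run f s (pair x n)) s)

runRec f g s x = primRec (run f s x) λ n r → natCase r 0 λ y → run g s (pair x (pair n y))

runᶜ : ∀ c → Computable₂ (run c)
runᶜ Zc = constᶜ 1
runᶜ Sc = sucᶜ (sucᶜ π₂ᶜ)
runᶜ Ic = sucᶜ π₂ᶜ
runᶜ Lc = sucᶜ (π₁ᶜ ∘ᶜ π₂ᶜ)
runᶜ Rc = sucᶜ (π₂ᶜ ∘ᶜ π₂ᶜ)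
runᶜ (Comp f g) = natCaseᶜ {s = λ w → run f (π₁ w)} (runᶜ g) (constᶜ 0) (ap₂ {k = run f} (runᶜ f) (π₁ᶜ ∘ᶜ π₁ᶜ) π₂ᶜ)
runᶜ (Pair f g) =
  natCaseᶜ {s = λ w y → natCase (run g (π₁ w) (π₂ w)) 0 λ z → suc (pair y z)} (runᶜ f) (constᶜ 0)
    (natCaseᶜ {s = λ w z → suc (pair (π₂ w) z)} (runᶜ g ∘ᶜ π₁ᶜ) (constᶜ 0)
      (sucᶜ (pairᶜ (π₂ᶜ ∘ᶜ π₁ᶜ) π₂ᶜ)))
runᶜ (Rec f g) =
  primRecᶜ {s = λ w n r → natCase r 0 λ y → run g (π₁ w) (pair (π₁ (π₂ w)) (pair n y))}
    (ap₂ {k = run f} (runᶜ f) π₁ᶜ (π₁ᶜ ∘ᶜ π₂ᶜ))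
    (natCaseᶜ {s = λ w y → run g (π₁ (π₁ w)) (pair (π₁ (π₂ (π₁ w))) (pair (π₁ (π₂ w)) y))} (π₂ᶜ ∘ᶜ π₂ᶜ) (constᶜ 0)
      (ap₂ {k = run g} (runᶜ g) (π₁ᶜ ∘ᶜ π₁ᶜ ∘ᶜ π₁ᶜ)
        (pairᶜ (π₁ᶜ ∘ᶜ π₂ᶜ ∘ᶜ π₁ᶜ ∘ᶜ π₁ᶜ) (pairᶜ (π₁ᶜ ∘ᶜ π₂ᶜ ∘ᶜ π₁ᶜ) π₂ᶜ))))
    (π₂ᶜ ∘ᶜ π₂ᶜ)
runᶜ (Min f) =
  predᶜ (primRecᶜ {s = λ w → minStep (λ n → run f (π₁ w) (pair (π₂ w) n))} (constᶜ 0)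
    (natCaseᶜ {s = λ _ q → suc q} (π₂ᶜ ∘ᶜ π₂ᶜ)
      (natCaseᶜ {s = λ w v → natCase v (2 + (π₁ (π₂ w))) (λ _ → 0)}
        (ap₂ {k = run f} (runᶜ f) (π₁ᶜ ∘ᶜ π₁ᶜ) (pairᶜ (π₂ᶜ ∘ᶜ π₁ᶜ) (π₁ᶜ ∘ᶜ π₂ᶜ)))
        (constᶜ 1)
        (natCaseᶜ {s = λ _ _ → 0} π₂ᶜ (sucᶜ (sucᶜ (π₁ᶜ ∘ᶜ π₂ᶜ ∘ᶜ π₁ᶜ))) (constᶜ 0)))
      (sucᶜ π₂ᶜ))
    π₁ᶜ)

natCase-suc : ∀ v {f : ℕ → ℕ} {y} → natCase v 0 f ≡ suc y → ∃ λ u → v ≡ suc u × f u ≡ suc y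
natCase-suc (suc u) eq = u , refl , eq

natCase-intro : ∀ {v u y} {f : ℕ → ℕ} → v ≡ suc u → f u ≡ suc y → natCase v 0 f ≡ suc y
natCase-intro refl eq = eq

-- In the convention of `run`, `1` is a defined zero and `2 + k` a defined positive value; as in
-- `ev-Min`, everything before the zero must be defined.
FirstZeroᵖ : (ℕ → ℕ) → ℕ → Set
FirstZeroᵖ v n = v n ≡ 1 × (∀ m → m < n → ∃ λ k → v m ≡ 2 + k)

minSearch-sound : ∀ v t → (minSearch v t ≡ 0 → ∀ m → m < t → ∃ λ k → v m ≡ 2 + k) ×
                          (∀ n → minSearch v t ≡ 2 + n → n < t × FirstZeroᵖ v n)
minSearch-sound v zero    = (λ _ _ ()) , λ _ ()
minSearch-sound v (suc t) with minSearch v t | minSearch-sound v t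
... | suc st | _ , found = (λ ()) , λ n eq → let n<t , first = found n eq in m≤n⇒m≤1+n n<t , first
... | zero | searching , _ with v t in vt
...   | 0 = (λ ()) , λ _ ()
...   | 1 = (λ ()) , λ { n refl → ≤-refl , vt , searching refl }
...   | suc (suc k) = (λ _ m m<1+t → case m≤n⇒m<n∨m≡n (s≤s⁻¹ m<1+t) of λ
          { (inj₁ m<t) → searching refl m m<t ; (inj₂ refl) → k , vt }) , λ _ ()

minSearch-before : ∀ v {n} → FirstZeroᵖ v n → ∀ t → t ≤ n → minSearch v t ≡ 0
minSearch-before v first zero    _ = refl
minSearch-before v first@(_ , vm) (suc t) t<n with vm t t<n
... | k , eq rewrite minSearch-before v first t (<⇒≤ t<n) | eq = refl

minSearch-complete : ∀ v {n} → FirstZeroᵖ v n → ∀ t → n < t → minSearch v t ≡ 2 + n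
minSearch-complete v {n} first (suc t) n<1+t with m≤n⇒m<n∨m≡n (s≤s⁻¹ n<1+t)
... | inj₁ n<t  rewrite minSearch-complete v first t n<t = refl
... | inj₂ refl rewrite minSearch-before v first n ≤-refl | proj₁ first = refl

pred-suc : ∀ m {n} → pred m ≡ suc n → m ≡ 2 + n
pred-suc (suc m) eq = cong suc eq

run-Min : ∀ f {s x n} → run (Min f) s x ≡ suc n → n < s × FirstZeroᵖ (λ m → run f s (pair x m)) n
run-Min f {s} {x} {n} eq = proj₂ (minSearch-sound _ s) n (pred-suc _ eq)

-- Only searches read the bound, and a successful search keeps its result because all values up to
-- its zero survive.
run-mono : ∀ c {s s′ x y} → s ≤ s′ → run c s x ≡ suc y → run c s′ x ≡ suc y
run-mono Zc le eq = eq
run-mono Sc le eq = eq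
run-mono Ic le eq = eq
run-mono Lc le eq = eq
run-mono Rc le eq = eq
run-mono (Comp f g) {s} {s′} {x} le eq =
  let u , gu , fu = natCase-suc (run g s x) eq in natCase-intro (run-mono g le gu) (run-mono f le fu)
run-mono (Pair f g) {s} {s′} {x} le eq =
  let u , fu , gu = natCase-suc (run f s x) eq
      v , gv , uv = natCase-suc (run g s x) gu
  in natCase-intro {f = λ y → natCase (run g s′ x) 0 λ z → suc (pair y z)}
       (run-mono f le fu) (natCase-intro (run-mono g le gv) uv)
run-mono (Rec f g) {s} {s′} {x} le = go (π₂ x)
  where
  go : ∀ n {y} → runRec f g s (π₁ x) n ≡ suc y → runRec f g s′ (π₁ x) n ≡ suc y
  go zero    eq = run-mono f le eq
  go (suc n) eq = let u , ru , gu = natCase-suc (runRec f g s (π₁ x) n) eq in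
    natCase-intro {f = λ y → run g s′ (pair (π₁ x) (pair n y))} (go n ru) (run-mono g le gu)
run-mono (Min f) {s} {s′} {x} {n} le eq =
  let n<s , fn , fm = run-Min f {s} {x} eq in
  cong pred (minSearch-complete (λ m → run f s′ (pair x m))
    (run-mono f le fn , λ m m<n → let k , fk = fm m m<n in k , run-mono f le fk) s′ (≤-trans n<s le))

run-sound : ∀ c {s x y} → run c s x ≡ suc y → Ev c x y
run-sound Zc refl = ev-Z
run-sound Sc refl = ev-S
run-sound Ic refl = ev-I
run-sound Lc refl = ev-L
run-sound Rc refl = ev-R
run-sound (Comp f g) {s} {x} eq =
  let u , gu , fu = natCase-suc (run g s x) eq in ev-Comp (run-sound g gu) (run-sound f fu)
run-sound (Pair f g) {s} {x} eq =
  let u , fu , gu = natCase-suc (run f s x) eq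
      v , gv , uv = natCase-suc (run g s x) gu
  in subst (Ev (Pair f g) x) (suc-injective uv) (ev-Pair (run-sound f fu) (run-sound g gv))
run-sound (Rec f g) {s} {x} {y} eq = subst (λ z → Ev (Rec f g) z y) (pair-π x) (go (π₂ x) eq)
  where
  go : ∀ n {y} → runRec f g s (π₁ x) n ≡ suc y → Ev (Rec f g) (pair (π₁ x) n) y
  go zero    eq = ev-Rec0 (run-sound f eq)
  go (suc n) eq = let u , ru , gu = natCase-suc (runRec f g s (π₁ x) n) eq in
    ev-RecS {x = π₁ x} {n = n} (go n ru) (run-sound g gu)
run-sound (Min f) {s} {x} {n} eq =
  let n<s , fn , fm = run-Min f {s} {x} eq in
  ev-Min (run-sound f fn) (λ m m<n → let k , fk = fm m m<n in k , run-sound f fk)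

uniformBound : ∀ {P : ℕ → ℕ → Set} → (∀ {m s s′} → s ≤ s′ → P m s → P m s′) →
               ∀ n → (∀ m → m < n → ∃ (P m)) → ∃ λ s → ∀ m → m < n → P m s
uniformBound mono zero    h = 0 , λ _ ()
uniformBound mono (suc n) h =
  let s , hs = uniformBound mono n (λ m m<n → h m (m≤n⇒m≤1+n m<n))
      t , ht = h n ≤-refl
  in s ⊔ t , λ m m<1+n → case m≤n⇒m<n∨m≡n (s≤s⁻¹ m<1+n) of λ
    { (inj₁ m<n) → mono (m≤m⊔n s t) (hs m m<n) ; (inj₂ refl) → mono (m≤n⊔m s t) ht }

run-Rec : ∀ f g s x n → run (Rec f g) s (pair x n) ≡ runRec f g s x n
run-Rec f g s x n = cong₂ (runRec f g s) (π₁-pair x n) (π₂-pair x n)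

run-complete : ∀ c {x y} → Ev c x y → ∃ λ s → run c s x ≡ suc y
run-complete Zc ev-Z = 0 , refl
run-complete Sc ev-S = 0 , refl
run-complete Ic ev-I = 0 , refl
run-complete Lc ev-L = 0 , refl
run-complete Rc ev-R = 0 , refl
run-complete (Comp f g) (ev-Comp G F) =
  let s , gs = run-complete g G
      t , ft = run-complete f F
  in s ⊔ t , natCase-intro (run-mono g (m≤m⊔n s t) gs) (run-mono f (m≤n⊔m s t) ft)
run-complete (Pair f g) (ev-Pair {x = x} F G) =
  let s , fs = run-complete f F
      t , gt = run-complete g G
  in s ⊔ t , natCase-intro {f = λ y → natCase (run g (s ⊔ t) x) 0 λ z → suc (pair y z)}
    (run-mono f (m≤m⊔n s t) fs) (natCase-intro (run-mono g (m≤n⊔m s t) gt) refl)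
run-complete (Rec f g) (ev-Rec0 {x = x} F) =
  let s , fs = run-complete f F in s , trans (run-Rec f g s x 0) fs
run-complete (Rec f g) (ev-RecS {x = x} {n = n} {y = y} E G) =
  let s , rs = run-complete (Rec f g) E
      t , gt = run-complete g G
  in s ⊔ t , trans (run-Rec f g (s ⊔ t) x (suc n))
    (natCase-intro {f = λ y → run g (s ⊔ t) (pair x (pair n y))}
      (trans (sym (run-Rec f g (s ⊔ t) x n)) (run-mono (Rec f g) {x = pair x n} (m≤m⊔n s t) rs))
      (run-mono g (m≤n⊔m s t) gt))
run-complete (Min f) (ev-Min {x = x} {n = n} F H) =
  let s , fs = run-complete f F
      t , ht = uniformBound {P = λ m s → ∃ λ k → run f s (pair x m) ≡ 2 + k}
                 (λ le (k , eq) → k , run-mono f le eq) n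
                 (λ m m<n → let k , E = H m m<n ; s , eq = run-complete f E in s , k , eq)
      -- The search has to pass `n` itself, whence `suc n`; `s` serves the value at `n` and `t` all
      -- the values before it.
      r = suc n ⊔ (s ⊔ t)
      s⊔t≤r = m≤n⊔m (suc n) (s ⊔ t)
  in r , cong pred (minSearch-complete (λ m → run f r (pair x m))
       ( run-mono f (≤-trans (m≤m⊔n s t) s⊔t≤r) fs
       , λ m m<n → let k , eq = ht m m<n in k , run-mono f (≤-trans (m≤n⊔m s t) s⊔t≤r) eq) r (m≤m⊔n (suc n) (s ⊔ t)))

-- Two derivations become two answers of the function `run` at a common bound.
Ev-deterministic : ∀ {c x y z} → Ev c x y → Ev c x z → y ≡ z
Ev-deterministic {c} E F =
  let s , es = run-complete c E
      t , ft = run-complete c F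
  in suc-injective (trans (sym (run-mono c (m≤m⊔n s t) es)) (run-mono c (m≤n⊔m s t) ft))

-- Searches, r.e. sets and the s-m-n theorem

eval₂ : ∀ {t : ℕ → ℕ → ℕ} (T : Computable₂ t) x y → Ev (code T) (pair x y) (t x y)
eval₂ {t} T x y = subst (Ev (code T) (pair x y)) (cong₂ t (π₁-pair x y) (π₂-pair x y)) (eval T (pair x y))

FirstZero : (ℕ → ℕ) → ℕ → Set
FirstZero t n = t n ≡ 0 × (∀ m → m < n → ∃ λ k → t m ≡ suc k)

firstZero : ∀ t n → t n ≡ 0 → ∃ (FirstZero t)
firstZero t n tn = case search n of λ { (inj₁ found) → found ; (inj₂ before) → n , tn , before }
  where
  search : ∀ n → ∃ (FirstZero t) ⊎ (∀ m → m < n → ∃ λ k → t m ≡ suc k)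
  search zero = inj₂ λ _ ()
  search (suc n) with search n
  ... | inj₁ found = inj₁ found
  ... | inj₂ before with t n in eq
  ...   | zero  = inj₁ (n , eq , before)
  ...   | suc k = inj₂ λ m m<1+n → case m≤n⇒m<n∨m≡n (s≤s⁻¹ m<1+n) of λ
          { (inj₁ m<n) → before m m<n ; (inj₂ refl) → k , eq }

ev-firstZero : ∀ {t : ℕ → ℕ → ℕ} (T : Computable₂ t) {x n} → FirstZero (t x) n → Ev (Min (code T)) x n
ev-firstZero T {x} {n} (tn , before) =
  ev-Min (subst (Ev (code T) (pair x n)) tn (eval₂ T x n))
         (λ m m<n → let k , eq = before m m<n in k , subst (Ev (code T) (pair x m)) eq (eval₂ T x m))

minᶜ : ∀ {t : ℕ → ℕ → ℕ} {u : ℕ → ℕ} → Computable₂ t → (∀ x → FirstZero (t x) (u x)) → Computable u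
minᶜ T first = mkC (Min (code T)) λ x → ev-firstZero T (first x)

dom-Min : ∀ {t : ℕ → ℕ → ℕ} (T : Computable₂ t) x →
          (∃ (Ev (Min (code T)) x) → ∃ λ s → t x s ≡ 0) × ((∃ λ s → t x s ≡ 0) → ∃ (Ev (Min (code T)) x))
dom-Min T x = (λ { (n , ev-Min E _) → n , Ev-deterministic (eval₂ T x n) E }) ,
              λ (s , ts) → let n , first = firstZero _ s ts in n , ev-firstZero T first

-- The index is that of an unbounded search for a witness `s`. As the test `t` is total, the search
-- halts exactly when a witness exists.
RE-Σ₁ : ∀ {A : ℕ → Set} {t : ℕ → ℕ → ℕ} → Computable₂ t →
        (∀ x → (A x → ∃ λ s → t x s ≡ 0) × ((∃ λ s → t x s ≡ 0) → A x)) → RE A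
RE-Σ₁ {A} T A⇔t = encode (Min (code T)) , subst (λ c → A ≐ λ x → ∃ (Ev c x)) (sym (decode-encode (Min (code T))))
  λ x → let to , from = A⇔t x ; domTo , domFrom = dom-Min T x in (λ ax → domFrom (to ax)) , λ w → from (domTo w)

sectionCode : Code → ℕ → Code
sectionCode d k = Comp d (Pair (constCode k) Ic)

-- Abstract for the same reason as recursive.
abstract
  section : Code → ℕ → ℕ
  section d k = encode (sectionCode d k)

  dom-section : ∀ d k y → (W (section d k) y → ∃ (Ev d (pair k y))) ×
                          (∃ (Ev d (pair k y)) → W (section d k) y)
  dom-section d k y rewrite decode-encode (sectionCode d k) = to , from
    where
    to : ∃ (Ev (sectionCode d k) y) → ∃ (Ev d (pair k y))
    to (v , ev-Comp (ev-Pair E ev-I) D) rewrite Ev-deterministic E (eval (constᶜ k) y) = v , D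
    from : ∃ (Ev d (pair k y)) → ∃ (Ev (sectionCode d k) y)
    from (v , D) = v , ev-Comp (ev-Pair (eval (constᶜ k) y) ev-I) D

  sectionᶜ : ∀ d → Computable (section d)
  -- `5` and `6` are the tags of `Comp` and `Pair`, and `2` is the code of `Ic`. In `const`, the
  -- inner `1` is the code of `Sc`.
  sectionᶜ d = comp 5 (constᶜ (encode d)) (comp 6 const (constᶜ 2))
    where
    *9ᶜ : ∀ {f : ℕ → ℕ} → Computable f → Computable (λ x → f x * 9)
    *9ᶜ {f} F = ext (λ x → eq (f x)) (primRecᶜ {s = λ _ _ r → 9 + r} (constᶜ 0) (constᶜ 9 +ᶜ π₂ᶜ ∘ᶜ π₂ᶜ) F)
      where
      eq : ∀ n → primRec 0 (λ _ r → 9 + r) n ≡ n * 9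
      eq zero    = refl
      eq (suc n) = cong (9 +_) (eq n)
    comp : ∀ r {f g : ℕ → ℕ} → Computable f → Computable g → Computable (λ x → r + pair (f x) (g x) * 9)
    comp r F G = constᶜ r +ᶜ *9ᶜ (pairᶜ F G)
    const : Computable (λ k → encode (constCode k))
    const = ext eq (primRecᶜ {s = λ _ _ r → 5 + pair 1 r * 9} (constᶜ 0) (comp 5 (constᶜ 1) (π₂ᶜ ∘ᶜ π₂ᶜ)) idᶜ)
      where
      eq : ∀ k → primRec 0 (λ _ r → 5 + pair 1 r * 9) k ≡ encode (constCode k)
      eq zero    = refl
      eq (suc k) = cong (λ r → 5 + pair 1 r * 9) (eq k)

-- Coded sequences

decodeM : ℕ → Maybe ℕ
decodeM zero    = nothing
decodeM (suc x) = just x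

codeM-decodeM : ∀ n → codeM (decodeM n) ≡ n
codeM-decodeM zero    = refl
codeM-decodeM (suc n) = refl

foldSeq : (ℕ → ℕ → ℕ) → ℕ → List (Maybe ℕ) → ℕ
foldSeq f = foldl (λ acc m → f acc (codeM m))

module _ (f : ℕ → ℕ → ℕ) where
  -- States are pairs of the accumulated value and the code of the remaining sequence.
  foldStep : ℕ → ℕ
  foldStep w = natCase (π₂ w) w λ q → pair (f (π₁ w) (π₁ q)) (π₂ q)

  foldIter : ℕ → ℕ → ℕ
  foldIter w = primRec w (λ _ → foldStep)

  -- The code of a sequence bounds its length and so serves as the number of iterations; surplus
  -- iterations leave an exhausted state unchanged.
  foldCode : ℕ → ℕ → ℕ
  foldCode b z = π₁ (foldIter (pair b z) z)

  foldStep-[] : ∀ b → foldStep (pair b 0) ≡ pair b 0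
  foldStep-[] b rewrite π₂-pair b 0 = refl

  foldStep-∷ : ∀ b x z → foldStep (pair b (suc (pair x z))) ≡ pair (f b x) z
  foldStep-∷ b x z
    rewrite π₂-pair b (suc (pair x z)) | π₁-pair b (suc (pair x z)) | π₁-pair x z | π₂-pair x z = refl

  -- Induction on the sequence consumes the first step, whereas `primRec` exposes the last.
  foldIter-shift : ∀ w n → foldIter w (suc n) ≡ foldIter (foldStep w) n
  foldIter-shift w zero    = refl
  foldIter-shift w (suc n) = cong foldStep (foldIter-shift w n)

  foldIter-codeSeq : ∀ σ b n → length σ ≤ n → π₁ (foldIter (pair b (codeSeq σ)) n) ≡ foldSeq f b σ
  foldIter-codeSeq [] b zero    _ = π₁-pair b 0
  foldIter-codeSeq [] b (suc n) _ = trans (cong π₁ (trans (foldIter-shift (pair b 0) n)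
    (cong (λ w → foldIter w n) (foldStep-[] b)))) (foldIter-codeSeq [] b n z≤n)
  foldIter-codeSeq (m ∷ σ) b (suc n) (s≤s le) = trans (cong π₁ (trans (foldIter-shift (pair b (codeSeq (m ∷ σ))) n)
    (cong (λ w → foldIter w n) (foldStep-∷ b (codeM m) (codeSeq σ))))) (foldIter-codeSeq σ (f b (codeM m)) n le)

length≤codeSeq : ∀ σ → length σ ≤ codeSeq σ
length≤codeSeq []      = z≤n
length≤codeSeq (m ∷ σ) = s≤s (≤-trans (length≤codeSeq σ) (n≤pair (codeM m) (codeSeq σ)))

foldCode-codeSeq : ∀ f b σ → foldCode f b (codeSeq σ) ≡ foldSeq f b σ
foldCode-codeSeq f b σ = foldIter-codeSeq f σ b (codeSeq σ) (length≤codeSeq σ)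

foldCodeᶜ : ∀ {f : ℕ → ℕ → ℕ} b → Computable₂ f → Computable (foldCode f b)
foldCodeᶜ {f} b F = π₁ᶜ ∘ᶜ primRecᶜ {s = λ _ _ → foldStep f} (pairᶜ (constᶜ b) idᶜ)
  (natCaseᶜ {s = λ w q → pair (f (π₁ (π₂ (π₂ w))) (π₁ q)) (π₂ q)} (π₂ᶜ ∘ᶜ π₂ᶜ ∘ᶜ π₂ᶜ) (π₂ᶜ ∘ᶜ π₂ᶜ)
    (pairᶜ (ap₂ {k = f} F (π₁ᶜ ∘ᶜ π₂ᶜ ∘ᶜ π₂ᶜ ∘ᶜ π₁ᶜ) (π₁ᶜ ∘ᶜ π₂ᶜ)) (π₂ᶜ ∘ᶜ π₂ᶜ)))
  idᶜ

-- `initSeg` grows at its end and `codeSeq` is built from the front; this front-first form mediates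
-- between them.
segment : Text → ℕ → ℕ → List (Maybe ℕ)
segment T i zero    = []
segment T i (suc j) = T i ∷ segment T (suc i) j

initSeg-segment : ∀ T i j → initSeg T (i + j) ≡ initSeg T i ++ segment T i j
initSeg-segment T i zero    rewrite +-identityʳ i = sym (++-identityʳ _)
initSeg-segment T i (suc j) rewrite +-suc i j = trans (initSeg-segment T (suc i) j) (++-assoc (initSeg T i) _ _)

initSeg-length : ∀ T n → n ≤ length (initSeg T n)
initSeg-length T n = subst (λ σ → n ≤ length σ) (sym (initSeg-segment T 0 n)) (go 0 n)
  where
  go : ∀ i j → j ≤ length (segment T i j)
  go i zero    = z≤n
  go i (suc j) = s≤s (go (suc i) j)

-- The code is assembled from the last entry backwards, so step `j` prepends the entry at
-- `n ∸ suc j`.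
initSegCode : (ℕ → ℕ) → ℕ → ℕ
initSegCode v n = primRec 0 (λ j r → suc (pair (v (n ∸ suc j)) r)) n

initSegCode≡ : ∀ T n → initSegCode (λ t → codeM (T t)) n ≡ codeSeq (initSeg T n)
initSegCode≡ T n = begin
  R n                             ≡⟨ go n ≤-refl ⟩
  codeSeq (segment T (n ∸ n) n)   ≡⟨ cong (λ i → codeSeq (segment T i n)) (n∸n≡0 n) ⟩
  codeSeq (segment T 0 n)         ≡⟨ cong codeSeq (initSeg-segment T 0 n) ⟨
  codeSeq (initSeg T n)           ∎
  where
  open ≡-Reasoning
  R : ℕ → ℕ
  R = primRec 0 (λ j r → suc (pair (codeM (T (n ∸ suc j))) r))
  go : ∀ j → j ≤ n → R j ≡ codeSeq (segment T (n ∸ j) j)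
  go zero    _   = refl
  go (suc j) j<n = cong (λ r → suc (pair (codeM (T (n ∸ suc j))) r))
    (trans (go j (<⇒≤ j<n)) (cong (λ i → codeSeq (segment T i j)) (+-∸-assoc 1 j<n)))

initSegCodeᶜ : ∀ {v : ℕ → ℕ → ℕ} → Computable₂ v → Computable₂ (λ k → initSegCode (v k))
initSegCodeᶜ {v} V = primRecᶜ {s = λ w j r → suc (pair (v (π₁ w) (π₂ w ∸ suc j)) r)} (constᶜ 0)
  (sucᶜ (pairᶜ (ap₂ {k = v} V (π₁ᶜ ∘ᶜ π₁ᶜ) (π₂ᶜ ∘ᶜ π₁ᶜ ∸ᶜ sucᶜ (π₁ᶜ ∘ᶜ π₂ᶜ))) (π₂ᶜ ∘ᶜ π₂ᶜ)))
  π₂ᶜ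

-- The equivalence relation and the family

module Classes (em : ExcludedMiddle 0ℓ) (Z : ℕ → Set) (a : ℕ → ℕ)
               (reZ : RE Z) (enum : AscendingEnumOfComplement Z a) (0∉Z : ¬ Z 0) where

  a-mono-≤ : ∀ {m n} → m ≤ n → a m ≤ a n
  a-mono-≤ {zero}  {zero}  _  = ≤-refl
  a-mono-≤ {m}     {suc n} le with m≤n⇒m<n∨m≡n le
  ... | inj₁ m<1+n = ≤-trans (a-mono-≤ (s≤s⁻¹ m<1+n)) (<⇒≤ (proj₁ enum n))
  ... | inj₂ refl  = ≤-refl

  a-cancel-< : ∀ {m n} → a m < a n → m < n
  a-cancel-< lt = ≰⇒> λ n≤m → <⇒≱ lt (a-mono-≤ n≤m)

  n≤a : ∀ n → n ≤ a n
  n≤a zero    = z≤n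
  n≤a (suc n) = ≤-<-trans (n≤a n) (proj₁ enum n)

  -- The index of the class of `y`, as the number of elements of the complement in `1, …, y`; `0` is
  -- `a 0` and is not counted. Membership in `Z` is decided classically, so this definition yields
  -- no algorithm.
  cls : ℕ → ℕ
  cls zero    = 0
  cls (suc y) with em {Z (suc y)}
  ... | yes _ = cls y
  ... | no  _ = suc (cls y)

  a-cls : ∀ y → a (cls y) ≤ y × y < a (suc (cls y))
  a-cls zero =
    let n , an≡0 = proj₁ (proj₂ enum 0) 0∉Z
    in subst (a 0 ≤_) an≡0 (a-mono-≤ z≤n) , ≤-<-trans z≤n (proj₁ enum 0)
  a-cls (suc y) with em {Z (suc y)} | a-cls y
  ... | yes y∈Z | lo , hi = m≤n⇒m≤1+n lo , ≤∧≢⇒< hi λ eq → proj₂ (proj₂ enum (suc y)) (_ , sym eq) y∈Z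
  ... | no  y∉Z | lo , hi with proj₁ (proj₂ enum (suc y)) y∉Z
  ...   | n , an≡1+y =
    -- `a n` is `suc y`, hence above `a (cls y)`, so `n` is at least `suc (cls y)`.
    subst (a (suc (cls y)) ≤_) an≡1+y (a-mono-≤ (a-cancel-< (subst (a (cls y) <_) (sym an≡1+y) (s≤s lo)))) ,
    ≤-<-trans hi (proj₁ enum (suc (cls y)))

  a≤⇒≤cls : ∀ {n y} → a n ≤ y → n ≤ cls y
  a≤⇒≤cls {y = y} le = s≤s⁻¹ (a-cancel-< (≤-<-trans le (proj₂ (a-cls y))))

  <a⇒cls≤ : ∀ {n y} → y < a (suc n) → cls y ≤ n
  <a⇒cls≤ {y = y} lt = s≤s⁻¹ (a-cancel-< (≤-<-trans (proj₁ (a-cls y)) lt))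

  cls-unique : ∀ {n y} → a n ≤ y → y < a (suc n) → cls y ≡ n
  cls-unique lo hi = ≤-antisym (<a⇒cls≤ hi) (a≤⇒≤cls lo)

  cls-a : ∀ n → cls (a n) ≡ n
  cls-a n = cls-unique ≤-refl (proj₁ enum n)

  cls-mono : ∀ {x y} → x ≤ y → cls x ≤ cls y
  cls-mono {x} le = a≤⇒≤cls (≤-trans (proj₁ (a-cls x)) le)

  zeta⇒cls≡ : ∀ {x y} → zeta a x y → cls x ≡ cls y
  zeta⇒cls≡ {x} {y} (n , lo , _ , hi) = trans
    (cls-unique (≤-trans lo (m⊓n≤m x y)) (≤-<-trans (m≤m⊔n x y) hi))
    (sym (cls-unique (≤-trans lo (m⊓n≤n x y)) (≤-<-trans (m≤n⊔m x y) hi)))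

  cls≡⇒zeta : ∀ {x y} → cls x ≡ cls y → zeta a x y
  cls≡⇒zeta {x} {y} eq = cls x ,
    ⊓-glb (proj₁ (a-cls x)) (subst (λ n → a n ≤ y) (sym eq) (proj₁ (a-cls y))) ,
    m⊓n≤m⊔n x y ,
    ⊔-lub (proj₂ (a-cls x)) (subst (λ n → y < a (suc n)) (sym eq) (proj₂ (a-cls y)))

  zCode : Code
  zCode = decode (proj₁ reZ)

  Z-run : ∀ {x} → Z x → ∃ λ s → ∃ λ v → run zCode s x ≡ suc v
  Z-run {x} x∈Z = let v , E = proj₁ (proj₂ reZ x) x∈Z ; s , eq = run-complete zCode E in s , v , eq

  run-Z : ∀ {s x v} → run zCode s x ≡ suc v → Z x
  run-Z {x = x} eq = proj₂ (proj₂ reZ x) (_ , run-sound zCode eq)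

  -- cls computed with the elements enumerated into Z by stage s.
  clsAt : ℕ → ℕ → ℕ
  clsAt s = primRec 0 (λ y r → natCase (run zCode s (suc y)) (suc r) (λ _ → r))

  clsAtᶜ : ∀ {s y : ℕ → ℕ} → Computable s → Computable y → Computable (λ x → clsAt (s x) (y x))
  clsAtᶜ = ap₂ {k = clsAt} (primRecᶜ {s = λ w y r → natCase (run zCode (π₁ w) (suc y)) (suc r) (λ _ → r)} (constᶜ 0)
    (natCaseᶜ {s = λ w _ → π₂ (π₂ w)}
      (ap₂ {k = run zCode} (runᶜ zCode) (π₁ᶜ ∘ᶜ π₁ᶜ) (sucᶜ (π₁ᶜ ∘ᶜ π₂ᶜ)))
      (sucᶜ (π₂ᶜ ∘ᶜ π₂ᶜ)) (π₂ᶜ ∘ᶜ π₂ᶜ ∘ᶜ π₁ᶜ))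
    π₂ᶜ)

  -- The guess is exact once the finitely many elements of `Z` up to `y` have appeared; elements of
  -- the complement never appear.
  clsAt-limit : ∀ y → ∃ λ s₀ → ∀ s → s₀ ≤ s → clsAt s y ≡ cls y
  clsAt-limit zero = 0 , λ _ _ → refl
  clsAt-limit (suc y) with em {Z (suc y)} | clsAt-limit y
  ... | yes y∈Z | s₀ , lim =
    let s₁ , v , eq = Z-run y∈Z in
    s₀ ⊔ s₁ , λ s le → trans
      (cong (λ u → natCase u (suc (clsAt s y)) (λ _ → clsAt s y)) (run-mono zCode (m⊔n≤o⇒n≤o s₀ s₁ le) eq))
      (lim s (m⊔n≤o⇒m≤o s₀ s₁ le))
  ... | no y∉Z | s₀ , lim = s₀ , λ s le → step s (lim s le)
    where
    step : ∀ s → clsAt s y ≡ cls y → clsAt s (suc y) ≡ suc (cls y)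
    step s eq with run zCode s (suc y) in r
    ... | zero  = cong suc eq
    ... | suc v = contradiction (run-Z r) y∉Z

  clsAt-mono-suc : ∀ s y → clsAt s y ≤ clsAt s (suc y)
  clsAt-mono-suc s y with run zCode s (suc y)
  ... | zero  = n≤1+n _
  ... | suc v = ≤-refl

  -- Gaps between class indices only shrink with the stage; both sides are moved to avoid subtraction.
  clsAt-gap : ∀ s {x y} → x ≤ y → cls y + clsAt s x ≤ clsAt s y + cls x
  clsAt-gap s {zero}  {zero}  _ = ≤-refl
  clsAt-gap s {x}     {suc y} x≤1+y with m≤n⇒m<n∨m≡n x≤1+y
  ... | inj₂ refl = ≤-reflexive (+-comm (cls x) (clsAt s x))
  ... | inj₁ x<1+y with em {Z (suc y)} | clsAt-gap s (s≤s⁻¹ x<1+y)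
  ...   | yes y∈Z | ih = ≤-trans ih (+-monoˡ-≤ (cls x) (clsAt-mono-suc s y))
  ...   | no  y∉Z | ih with run zCode s (suc y) in r
  ...     | zero  = s≤s ih
  ...     | suc v = contradiction (run-Z r) y∉Z

  cls≤clsAt : ∀ s y → cls y ≤ clsAt s y
  cls≤clsAt s y = subst₂ _≤_ (+-identityʳ _) (+-identityʳ _) (clsAt-gap s {0} {y} z≤n)

  -- True gaps never exceed estimated ones, so an upper bound on a gap observed at a single stage is
  -- already correct. This is what makes `Near` recursively enumerable.
  clsAt-≤⇒cls-≤ : ∀ s x y c → clsAt s y ≤ clsAt s x + c → cls y ≤ cls x + c
  clsAt-≤⇒cls-≤ s x y c le with ≤-total y x
  ... | inj₁ y≤x = ≤-trans (cls-mono y≤x) (m≤m+n _ c)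
  ... | inj₂ x≤y = +-cancelʳ-≤ (clsAt s x) _ _ (begin
    cls y + clsAt s x          ≤⟨ clsAt-gap s x≤y ⟩
    clsAt s y + cls x          ≤⟨ +-monoˡ-≤ (cls x) le ⟩
    clsAt s x + c + cls x      ≡⟨ +-assoc (clsAt s x) c (cls x) ⟩
    clsAt s x + (c + cls x)    ≡⟨ +-comm (clsAt s x) (c + cls x) ⟩
    c + cls x + clsAt s x      ≡⟨ cong (_+ clsAt s x) (+-comm c (cls x)) ⟩
    cls x + c + clsAt s x      ∎)
    where open ≤-Reasoning

  -- One relation serves twice: `c = 0` gives the equivalence itself, and `c = x = k` gives the
  -- member `B k` of the family.
  Near : ℕ → ℕ → ℕ → Set
  Near c x y = cls x ≤ cls y × cls y ≤ cls x + c

  nearTest : ℕ → ℕ → ℕ → ℕ → ℕ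
  nearTest c x y s = (clsAt s x ∸ clsAt s y) + (clsAt s y ∸ (clsAt s x + c))

  nearTestᶜ : ∀ {c x y s : ℕ → ℕ} → Computable c → Computable x → Computable y → Computable s →
              Computable (λ w → nearTest (c w) (x w) (y w) (s w))
  nearTestᶜ C X Y S = (clsAtᶜ S X ∸ᶜ clsAtᶜ S Y) +ᶜ (clsAtᶜ S Y ∸ᶜ (clsAtᶜ S X +ᶜ C))

  nearTest-zero : ∀ c x y s → nearTest c x y s ≡ 0 → Near c x y
  nearTest-zero c x y s eq =
    subst (cls x ≤_) (+-identityʳ _) (clsAt-≤⇒cls-≤ s y x 0
      (subst (clsAt s x ≤_) (sym (+-identityʳ _)) (m∸n≡0⇒m≤n (m+n≡0⇒m≡0 (clsAt s x ∸ clsAt s y) eq)))) ,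
    clsAt-≤⇒cls-≤ s x y c (m∸n≡0⇒m≤n (m+n≡0⇒n≡0 (clsAt s x ∸ clsAt s y) eq))

  Near-nearTest : ∀ c x y → Near c x y → ∃ λ s → nearTest c x y s ≡ 0
  Near-nearTest c x y (lo , hi) = s , eq
    where
    s₁ = clsAt-limit x
    s₂ = clsAt-limit y
    s = proj₁ s₁ ⊔ proj₁ s₂
    eq : nearTest c x y s ≡ 0
    eq rewrite proj₂ s₁ s (m≤m⊔n _ _) | proj₂ s₂ s (m≤n⊔m (proj₁ s₁) _) =
      cong₂ _+_ (m≤n⇒m∸n≡0 lo) (m≤n⇒m∸n≡0 hi)

  positive : PositiveEquivalence (zeta a)
  positive = equiv , re , infinite
    where
    equiv : IsEquivalence (zeta a)
    equiv = record
      { refl  = cls≡⇒zeta refl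
      ; sym   = λ xy → cls≡⇒zeta (sym (zeta⇒cls≡ xy))
      ; trans = λ xy yz → cls≡⇒zeta (trans (zeta⇒cls≡ xy) (zeta⇒cls≡ yz)) }
    re : RERel (zeta a)
    re = RE-Σ₁ {t = λ z → nearTest 0 (π₁ z) (π₂ z)}
      (nearTestᶜ (constᶜ 0) (π₁ᶜ ∘ᶜ π₁ᶜ) (π₂ᶜ ∘ᶜ π₁ᶜ) π₂ᶜ)
      λ z → (λ xy → let eq = zeta⇒cls≡ xy in
               Near-nearTest 0 (π₁ z) (π₂ z) (≤-reflexive eq , ≤-trans (≤-reflexive (sym eq)) (m≤m+n _ 0))) ,
            (λ (s , eq) → let lo , hi = nearTest-zero 0 (π₁ z) (π₂ z) s eq in
               cls≡⇒zeta (≤-antisym lo (subst (cls (π₂ z) ≤_) (+-identityʳ _) hi)))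
    distinct : ∀ n {y} → y ≤ n → ¬ zeta a (a (suc n)) y
    distinct n {y} y≤n xy = 1+n≰n (begin
      suc n             ≡⟨ cls-a (suc n) ⟨
      cls (a (suc n))   ≡⟨ zeta⇒cls≡ xy ⟩
      cls y             ≤⟨ n≤a (cls y) ⟩
      a (cls y)         ≤⟨ proj₁ (a-cls y) ⟩
      y                 ≤⟨ y≤n ⟩
      n                 ∎)
      where open ≤-Reasoning
    ≤sum : ∀ xs → All (_≤ sum xs) xs
    ≤sum []       = []
    ≤sum (x ∷ xs) = m≤m+n x _ ∷ mapAll (λ le → ≤-trans le (m≤n+m _ x)) (≤sum xs)
    infinite : InfinitelyManyClasses (zeta a)
    -- The index of a class is at most each of its elements, so no entry of the list lies in a class
    -- beyond number `sum xs`.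
    infinite xs = a (suc (sum xs)) , mapAll (distinct (sum xs)) (≤sum xs)

  B : ℕ → ℕ → Set
  B k = Near k k

  B-closed : ∀ k → Closed (zeta a) (B k)
  B-closed k x y xy (lo , hi) = subst (cls k ≤_) eq lo , subst (_≤ cls k + k) eq hi
    where eq = zeta⇒cls≡ xy

  k∈B : ∀ k → B k k
  k∈B k = ≤-refl , m≤m+n _ k

  top∈B : ∀ k → B k (a (cls k + k))
  top∈B k = subst (cls k ≤_) (sym (cls-a (cls k + k))) (m≤m+n _ k) , ≤-reflexive (cls-a (cls k + k))

  -- Since `i` lies in `B j`, the lowest class of `B j` is not above that of `B i`; since the top
  -- class of `B i` lies in `B j`, it is not above that of `B j`. Hence `i ≤ j`, and symmetrically.
  B-injective : ∀ {i j} → B i ≐ B j → i ≡ j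
  B-injective {i} {j} eq = ≤-antisym (go eq) (go λ x → let to , from = eq x in from , to)
    where
    go : ∀ {i j} → B i ≐ B j → i ≤ j
    go {i} {j} eq = +-cancelˡ-≤ (cls i) i j (begin
      cls i + i             ≡⟨ cls-a (cls i + i) ⟨
      cls (a (cls i + i))   ≤⟨ proj₂ (proj₁ (eq (a (cls i + i))) (top∈B i)) ⟩
      cls j + j             ≤⟨ +-monoˡ-≤ j (proj₁ (proj₁ (eq i) (k∈B i))) ⟩
      cls i + j             ∎)
      where open ≤-Reasoning

  Bᶜ : Computable₂ (λ w → nearTest (π₁ w) (π₁ w) (π₂ w))
  Bᶜ = nearTestᶜ (π₁ᶜ ∘ᶜ π₁ᶜ) (π₁ᶜ ∘ᶜ π₁ᶜ) (π₂ᶜ ∘ᶜ π₁ᶜ) π₂ᶜ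

  family : IsFamily (zeta a) B
  family = B-closed ,
    RE-Σ₁ Bᶜ (λ z → Near-nearTest (π₁ z) (π₁ z) (π₂ z) , λ (s , eq) → nearTest-zero (π₁ z) (π₁ z) (π₂ z) s eq) ,
    λ i j i≢j eq → i≢j (B-injective eq)

  index : ℕ → ℕ
  index = section (Min (code Bᶜ))

  indexᶜ : Computable index
  indexᶜ = sectionᶜ (Min (code Bᶜ))

  W-index : ∀ k → W (index k) ≐ B k
  W-index k y =
    (λ w → let s , eq = proj₁ min (proj₁ sec w) in nearTest-zero k k y s (trans (sym (test s)) eq)) ,
    (λ b → let s , eq = Near-nearTest k k y b in proj₂ sec (proj₂ min (s , trans (test s) eq)))
    where
    t : ℕ → ℕ → ℕ
    t w = nearTest (π₁ w) (π₁ w) (π₂ w)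
    sec = dom-section (Min (code Bᶜ)) k y
    min = dom-Min {t = t} Bᶜ (pair k y)
    test : ∀ s → t (pair k y) s ≡ nearTest k k y s
    test s = cong₂ (λ k y → nearTest k k y s) (π₁-pair k y) (π₂-pair k y)

  Hyp-index : ∀ k → Hyp (zeta a) (index k) ≐ B k
  Hyp-index k x = (λ (y , xy , w) → B-closed k y x (cls≡⇒zeta (sym (zeta⇒cls≡ xy))) (proj₁ (W-index k y) w)) ,
                  (λ b → x , cls≡⇒zeta refl , proj₂ (W-index k x) b)

-- Confident learning

_∈ᵀ_ : ℕ → Text → Set
x ∈ᵀ T = ∃ λ i → T i ≡ just x

⊓ᶜ : Computable₂ _⊓_
⊓ᶜ = ext (λ w → eq (π₁ w) (π₂ w)) (π₁ᶜ ∸ᶜ (π₁ᶜ ∸ᶜ π₂ᶜ))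
  where
  eq : ∀ m n → m ∸ (m ∸ n) ≡ m ⊓ n
  eq zero    n       = 0∸n≡0 (0 ∸ n)
  eq (suc m) zero    = n∸n≡0 m
  eq (suc m) (suc n) = trans (+-∸-assoc 1 (m∸n≤m m n)) (cong suc (eq m n))

⊔ᶜ : Computable₂ _⊔_
⊔ᶜ = ext (λ w → eq (π₁ w) (π₂ w)) (π₁ᶜ +ᶜ (π₂ᶜ ∸ᶜ π₁ᶜ))
  where
  eq : ∀ m n → m + (n ∸ m) ≡ m ⊔ n
  eq zero    n       = refl
  eq (suc m) zero    = cong suc (+-identityʳ m)
  eq (suc m) (suc n) = cong suc (eq m n)

-- Running minimum and maximum are treated at once; `x ≼ y` says that `x` is at least as extreme as
-- `y`.
module Extremum (_∙_ : ℕ → ℕ → ℕ) (_≼_ : ℕ → ℕ → Set)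
                (≼-trans : ∀ {x y z} → x ≼ y → y ≼ z → x ≼ z)
                (≼-antisym : ∀ {x y} → x ≼ y → y ≼ x → x ≡ y)
                (∙-sel : ∀ x y → x ∙ y ≡ x ⊎ x ∙ y ≡ y)
                (∙-≼ˡ : ∀ x y → (x ∙ y) ≼ x) (∙-≼ʳ : ∀ x y → (x ∙ y) ≼ y)
                (≼-refl : ∀ {x} → x ≼ x) where

  -- 0 is the extremum of the empty set, suc q stands for q.
  update : ℕ → ℕ → ℕ
  update acc e = natCase e acc λ p → natCase acc (suc p) λ q → suc (q ∙ p)

  updateᶜ : Computable₂ _∙_ → Computable₂ update
  updateᶜ ∙ᶜ = natCaseᶜ {s = λ w p → natCase (π₁ w) (suc p) λ q → suc (q ∙ p)} π₂ᶜ π₁ᶜ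
    (natCaseᶜ {s = λ w q → suc (q ∙ π₂ w)} (π₁ᶜ ∘ᶜ π₁ᶜ) (sucᶜ π₂ᶜ)
      (sucᶜ (ap₂ {k = _∙_} ∙ᶜ π₂ᶜ (π₂ᶜ ∘ᶜ π₁ᶜ))))

  best : Text → ℕ → ℕ
  best T n = foldSeq update 0 (initSeg T n)

  best-suc : ∀ T n → best T (suc n) ≡ update (best T n) (codeM (T n))
  best-suc T n = foldl-++ _ 0 (initSeg T n) (T n ∷ [])

  best-∈ : ∀ T n {q} → best T n ≡ suc q → q ∈ᵀ T
  best-∈ T (suc n) eq with T n in Tn | best T n in b | trans (sym (best-suc T n)) eq
  ... | nothing | suc q | refl = best-∈ T n b
  ... | just p  | zero  | refl = n , Tn
  ... | just p  | suc q | refl with ∙-sel q p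
  ...   | inj₁ s = best-∈ T n (trans b (cong suc (sym s)))
  ...   | inj₂ s = n , trans Tn (cong just (sym s))

  best-≼ : ∀ T {n i y} → i < n → T i ≡ just y → ∃ λ q → best T n ≡ suc q × q ≼ y
  best-≼ T {suc n} {i} i<1+n Ti with m≤n⇒m<n∨m≡n (s≤s⁻¹ i<1+n)
  best-≼ T {suc n} {i} {y} i<1+n Ti | inj₁ i<n with best-≼ T i<n Ti
  ... | q , bq , q≼y with T n | best-suc T n
  ...   | nothing | eq = q , trans eq (cong (λ b → update b 0) bq) , q≼y
  ...   | just p  | eq = q ∙ p , trans eq (cong (λ b → update b (suc p)) bq) , ≼-trans (∙-≼ˡ q p) q≼y
  best-≼ T {suc n} {i} {y} i<1+n Ti | inj₂ refl with best T n | best-suc T n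
  ... | zero  | eq = y , trans eq (cong (λ m → update 0 (codeM m)) Ti) , ≼-refl
  ... | suc q | eq = q ∙ y , trans eq (cong (λ m → update (suc q) (codeM m)) Ti) , ∙-≼ʳ q y

  best-limit : ∀ T {m} → m ∈ᵀ T → (∀ y → y ∈ᵀ T → m ≼ y) → ∃ λ n₀ → ∀ n → n₀ ≤ n → best T n ≡ suc m
  best-limit T {m} (i , Ti) m≼ = suc i , λ n i<n →
    let q , bq , q≼m = best-≼ T i<n Ti in trans bq (cong suc (≼-antisym q≼m (m≼ q (best-∈ T n bq))))

  best-empty : ∀ T → (∀ y → ¬ y ∈ᵀ T) → ∀ n → best T n ≡ 0
  best-empty T empty n with best T n in b
  ... | zero  = refl
  ... | suc q = contradiction (best-∈ T n b) (empty q)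

module Min⊓ = Extremum _⊓_ _≤_ ≤-trans ≤-antisym ⊓-sel m⊓n≤m m⊓n≤n ≤-refl
module Max⊔ = Extremum _⊔_ _≥_ (flip ≤-trans) (flip ≤-antisym) ⊔-sel m≤m⊔n m≤n⊔m ≤-refl

module _ (em : ExcludedMiddle 0ℓ) where
  least : ∀ {P : ℕ → Set} → ∃ P → ∃ λ m → P m × (∀ y → P y → m ≤ y)
  least {P} (w , pw) = case search w of λ
    { (inj₁ found) → found ; (inj₂ none) → w , pw , λ y py → ≮⇒≥ λ y<w → none y y<w py }
    where
    search : ∀ n → (∃ λ m → P m × (∀ y → P y → m ≤ y)) ⊎ (∀ y → y < n → ¬ P y)
    search zero = inj₂ λ _ ()
    search (suc n) with search n
    ... | inj₁ found = inj₁ found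
    ... | inj₂ none with em {P n}
    ...   | yes pn = inj₁ (n , pn , λ y py → ≮⇒≥ λ y<n → none y y<n py)
    ...   | no ¬pn = inj₂ λ y y<1+n → case m≤n⇒m<n∨m≡n (s≤s⁻¹ y<1+n) of λ
              { (inj₁ y<n) → none y y<n ; (inj₂ refl) → ¬pn }

  greatest : ∀ {P : ℕ → Set} b → (∀ y → P y → y ≤ b) → ∃ P → ∃ λ m → P m × (∀ y → P y → m ≥ y)
  greatest {P} b bound w with em {P b}
  ... | yes pb = b , pb , bound
  greatest zero bound (y , py) | no ¬pb with bound y py
  ... | z≤n = contradiction py ¬pb
  greatest (suc b) bound w | no ¬pb = greatest b (λ y py → case m≤n⇒m<n∨m≡n (bound y py) of λ
    { (inj₁ y<1+b) → s≤s⁻¹ y<1+b ; (inj₂ refl) → contradiction py ¬pb }) w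

module ConfidentLearner (em : ExcludedMiddle 0ℓ) (Z : ℕ → Set) (a : ℕ → ℕ)
               (reZ : RE Z) (enum : AscendingEnumOfComplement Z a) (0∉Z : ¬ Z 0) where
  open Classes em Z a reZ enum 0∉Z

  -- If the data run from class c m to class c x, then only B (c x ∸ c m) comes into question;
  -- it begins with the class of m only if c x ∸ c m itself lies in that class.
  guess : (ℕ → ℕ) → ℕ → ℕ → ℕ
  guess c m x = natCase (c (c x ∸ c m) ∸ c m) (suc (index (c x ∸ c m))) (λ _ → 0)

  -- Without data both default to `0`. This is harmless: no `B k` is empty, and on the empty set
  -- only convergence is required.
  lowest highest : ℕ → ℕ
  lowest  z = pred (foldCode Min⊓.update 0 z)
  highest z = pred (foldCode Max⊔.update 0 z)

  -- The code of the data doubles as the stage of the enumeration of `Z`; it tends to infinity along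
  -- every text.
  output : ℕ → ℕ
  output z = guess (clsAt z) (lowest z) (highest z)

  outputᶜ : Computable output
  outputᶜ = natCaseᶜ {s = λ _ _ → 0} (clsAtᶜ idᶜ kᶜ ∸ᶜ clsAtᶜ idᶜ mᶜ)
    (sucᶜ (indexᶜ ∘ᶜ kᶜ)) (constᶜ 0)
    where
    mᶜ : Computable lowest
    mᶜ = predᶜ (foldCodeᶜ {f = Min⊓.update} 0 (Min⊓.updateᶜ ⊓ᶜ))
    xᶜ : Computable highest
    xᶜ = predᶜ (foldCodeᶜ {f = Max⊔.update} 0 (Max⊔.updateᶜ ⊔ᶜ))
    kᶜ : Computable (λ z → clsAt z (highest z) ∸ clsAt z (lowest z))
    kᶜ = clsAtᶜ idᶜ xᶜ ∸ᶜ clsAtᶜ idᶜ mᶜ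

  M : List (Maybe ℕ) → Maybe ℕ
  M σ = decodeM (output (codeSeq σ))

  M-recursive : RecursiveLearner M
  M-recursive = let e , φe = recursive outputᶜ in
    e , λ σ → subst (φ e (codeSeq σ)) (sym (codeM-decodeM (output (codeSeq σ)))) (φe (codeSeq σ))

  stage : Text → ℕ → ℕ
  stage T n = codeSeq (initSeg T n)

  n≤stage : ∀ T n → n ≤ stage T n
  n≤stage T n = ≤-trans (initSeg-length T n) (length≤codeSeq (initSeg T n))

  lowest-stage : ∀ T n → lowest (stage T n) ≡ pred (Min⊓.best T n)
  lowest-stage T n = cong pred (foldCode-codeSeq Min⊓.update 0 (initSeg T n))

  highest-stage : ∀ T n → highest (stage T n) ≡ pred (Max⊔.best T n)
  highest-stage T n = cong pred (foldCode-codeSeq Max⊔.update 0 (initSeg T n))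

  guess-cong : ∀ c d m x → c m ≡ d m → c x ≡ d x → c (d x ∸ d m) ≡ d (d x ∸ d m) → guess c m x ≡ guess d m x
  guess-cong c d m x eqm eqx eqk rewrite eqx | eqm | eqk = refl

  -- Three class indices are consulted. The argument of the third depends on the first two, but it
  -- is fixed once these have settled.
  guess-limit : ∀ m x → ∃ λ s₀ → ∀ s → s₀ ≤ s → guess (clsAt s) m x ≡ guess cls m x
  guess-limit m x =
    let s₁ , lim₁ = clsAt-limit m
        s₂ , lim₂ = clsAt-limit x
        s₃ , lim₃ = clsAt-limit (cls x ∸ cls m)
    in s₁ ⊔ (s₂ ⊔ s₃) , λ s le → let le′ = m⊔n≤o⇒n≤o s₁ (s₂ ⊔ s₃) le in guess-cong (clsAt s) cls m x
      (lim₁ s (m⊔n≤o⇒m≤o s₁ (s₂ ⊔ s₃) le)) (lim₂ s (m⊔n≤o⇒m≤o s₂ s₃ le′)) (lim₃ s (m⊔n≤o⇒n≤o s₂ s₃ le′))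

  converges : ∀ T {m x} → (∃ λ n₀ → ∀ n → n₀ ≤ n → Min⊓.best T n ≡ m) →
              (∃ λ n₀ → ∀ n → n₀ ≤ n → Max⊔.best T n ≡ x) →
              ∃ λ n₀ → ∀ n → n₀ ≤ n → M (initSeg T n) ≡ decodeM (guess cls (pred m) (pred x))
  converges T {m} {x} (n₁ , lim₁) (n₂ , lim₂) =
    let s₀ , lim = guess-limit (pred m) (pred x)
    in n₁ ⊔ (n₂ ⊔ s₀) , λ n le →
      let le′ = m⊔n≤o⇒n≤o n₁ (n₂ ⊔ s₀) le in
      cong decodeM (trans
        (cong₂ (guess (clsAt (stage T n)))
          (trans (lowest-stage T n) (cong pred (lim₁ n (m⊔n≤o⇒m≤o n₁ (n₂ ⊔ s₀) le))))
          (trans (highest-stage T n) (cong pred (lim₂ n (m⊔n≤o⇒m≤o n₂ s₀ le′)))))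
        (lim (stage T n) (≤-trans (m⊔n≤o⇒n≤o n₂ s₀ le′) (n≤stage T n))))

  -- The estimated spread may change forever, but it eventually stays at or above `K`, the first
  -- element of the class after that of `m`. It then lies outside the class of `m` and the output is
  -- `?`.
  converges-unbounded : ∀ T {m} → (∃ λ n₀ → ∀ n → n₀ ≤ n → Min⊓.best T n ≡ suc m) →
                        (∀ b → ∃ λ y → b < y × y ∈ᵀ T) →
                        ∃ λ n₀ → ∀ n → n₀ ≤ n → M (initSeg T n) ≡ nothing
  converges-unbounded T {m} (n₁ , lim₁) unbounded =
    n₁ ⊔ (s₀ ⊔ suc i) , λ n le →
      let le′ = m⊔n≤o⇒n≤o n₁ (s₀ ⊔ suc i) le in
      silent n (lim₁ n (m⊔n≤o⇒m≤o n₁ (s₀ ⊔ suc i) le))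
        (lim (stage T n) (≤-trans (m⊔n≤o⇒m≤o s₀ (suc i) le′) (n≤stage T n)))
        (Max⊔.best-≼ T (m⊔n≤o⇒n≤o s₀ (suc i) le′) (proj₂ (proj₂ (proj₂ far))))
    where
    K = a (suc (cls m))
    s₀ = proj₁ (clsAt-limit m)
    lim = proj₂ (clsAt-limit m)
    -- A datum beyond `a (cls m + K)` has class index at least `cls m + K`, and estimates never fall
    -- below true indices, so the spread is at least `K`.
    far = unbounded (a (cls m + K))
    y = proj₁ far
    i = proj₁ (proj₂ (proj₂ far))
    silent : ∀ n → Min⊓.best T n ≡ suc m → clsAt (stage T n) m ≡ cls m →
             (∃ λ q → Max⊔.best T n ≡ suc q × q ≥ y) → M (initSeg T n) ≡ nothing
    silent n bm cm (q , bq , y≤q)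
      rewrite trans (lowest-stage T n) (cong pred bm) | trans (highest-stage T n) (cong pred bq) | cm =
      cong decodeM (positive⇒0 (m<n⇒0<n∸m (begin-strict
        cls m                       <⟨ a≤⇒≤cls ≤-refl ⟩
        cls K                       ≤⟨ cls-mono K≤k ⟩
        cls (clsAt s q ∸ cls m)     ≤⟨ cls≤clsAt s (clsAt s q ∸ cls m) ⟩
        clsAt s (clsAt s q ∸ cls m) ∎)))
      where
      open ≤-Reasoning
      s = stage T n
      positive⇒0 : ∀ {v u} → 0 < v → natCase v u (λ _ → 0) ≡ 0
      positive⇒0 (s≤s _) = refl
      K≤k : K ≤ clsAt s q ∸ cls m
      K≤k = subst (_≤ clsAt s q ∸ cls m) (m+n∸m≡n (cls m) K) (∸-monoˡ-≤ (cls m)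
        (≤-trans (a≤⇒≤cls (≤-trans (<⇒≤ (proj₁ (proj₂ far))) y≤q)) (cls≤clsAt s q)))

  -- No data, bounded data or unbounded data: the case is decided classically, in the proof and not
  -- by the learner.
  always-converges : ∀ T → ∃ λ n → ∃ λ o → ∀ m → n ≤ m → M (initSeg T m) ≡ o
  always-converges T with em {∃ λ y → y ∈ᵀ T}
  ... | no empty = let n , lim = converges T (0 , λ n _ → Min⊓.best-empty T none n)
                                              (0 , λ n _ → Max⊔.best-empty T none n)
                   in n , _ , lim
    where
    none : ∀ y → ¬ y ∈ᵀ T
    none y y∈T = empty (y , y∈T)
  ... | yes w with least em w | em {∃ λ b → ∀ y → y ∈ᵀ T → y ≤ b}
  ...   | m , m∈T , m≤ | yes (b , bound) =
    let x , x∈T , x≥ = greatest em b bound w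
        n , lim = converges T (Min⊓.best-limit T m∈T m≤) (Max⊔.best-limit T x∈T x≥)
    in n , _ , lim
  ...   | m , m∈T , m≤ | no unbounded =
    let n , lim = converges-unbounded T (Min⊓.best-limit T m∈T m≤) far in n , _ , lim
    where
    far : ∀ b → ∃ λ y → b < y × y ∈ᵀ T
    far b with em {∃ λ y → b < y × y ∈ᵀ T}
    ... | yes found = found
    ... | no  none  = contradiction (b , λ y y∈T → ≮⇒≥ λ b<y → none (y , b<y , y∈T)) unbounded

  learns : ∀ k T → IsTextFor (B k) T →
           ∃ λ n → ∃ λ e → (∀ m → n ≤ m → M (initSeg T m) ≡ just e) × (Hyp (zeta a) e ≐ B k)
  learns k T text = n , index k , (λ j n≤j → trans (lim j n≤j) (cong decodeM final)) , Hyp-index k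
    where
    k∈T : k ∈ᵀ T
    k∈T = proj₁ (text k) (k∈B k)
    bound : ∀ y → y ∈ᵀ T → y ≤ a (suc (cls k + k))
    bound y y∈T = <⇒≤ (<-≤-trans (proj₂ (a-cls y)) (a-mono-≤ (s≤s (proj₂ (proj₂ (text y) y∈T)))))
    lo = least em (k , k∈T)
    hi = greatest em (a (suc (cls k + k))) bound (k , k∈T)
    m = proj₁ lo
    x = proj₁ hi
    conv = converges T (Min⊓.best-limit T (proj₁ (proj₂ lo)) (proj₂ (proj₂ lo)))
                       (Max⊔.best-limit T (proj₁ (proj₂ hi)) (proj₂ (proj₂ hi)))
    n = proj₁ conv
    lim = proj₂ conv
    cls-m : cls m ≡ cls k
    cls-m = ≤-antisym (cls-mono (proj₂ (proj₂ lo) k k∈T)) (proj₁ (proj₂ (text m) (proj₁ (proj₂ lo))))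
    cls-x : cls x ≡ cls k + k
    cls-x = ≤-antisym (proj₂ (proj₂ (text x) (proj₁ (proj₂ hi))))
      (a≤⇒≤cls (proj₂ (proj₂ hi) _ (proj₁ (text _) (top∈B k))))
    -- The spread is exactly `k`, which lies in the class of `m`, so the test in `guess` yields `0`
    -- and the index of `B k` is put out.
    final : guess cls m x ≡ suc (index k)
    final rewrite cls-x | cls-m | m+n∸m≡n (cls k) k | n∸n≡0 (cls k) = refl

  confident : ConfidentlyLearns (zeta a) M B
  confident = learns , λ L T _ → always-converges T

-- Finite learning

initSeg-cong : ∀ {S T : Text} n → (∀ t → t < n → S t ≡ T t) → initSeg S n ≡ initSeg T n
initSeg-cong zero    eq = refl
initSeg-cong (suc n) eq = cong₂ (λ σ m → σ ++ (m ∷ [])) (initSeg-cong n λ t t<n → eq t (m≤n⇒m≤1+n t<n)) (eq n ≤-refl)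

splice : ℕ → Text → Text → Text
splice n S T t with t <? n
... | yes _ = S t
... | no  _ = T (t ∸ n)

splice-< : ∀ n S T {t} → t < n → splice n S T t ≡ S t
splice-< n S T {t} t<n with t <? n
... | yes _   = refl
... | no  t≮n = contradiction t<n t≮n

splice-+ : ∀ n S T t → splice n S T (n + t) ≡ T t
splice-+ n S T t with n + t <? n
... | yes n+t<n = contradiction n+t<n (m+n≮m n t)
... | no  _     = cong T (m+n∸m≡n n t)

splice-text : ∀ {L : ℕ → Set} n S T → IsTextFor L T →
              (∀ t x → t < n → S t ≡ just x → L x) → IsTextFor L (splice n S T)
splice-text {L} n S T text sub x = to , from
  where
  to : L x → x ∈ᵀ splice n S T
  to lx = let t , eq = proj₁ (text x) lx in n + t , trans (splice-+ n S T t) eq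
  from : x ∈ᵀ splice n S T → L x
  from (t , eq) with t <? n
  ... | yes t<n = sub t x t<n eq
  ... | no  _   = proj₂ (text x) (_ , eq)

-- A finite learner never revises its first answer. An answer on a common initial segment is
-- therefore the final one on `T′` as well, and its hypothesis is both sets.
FinitelyLearns-unique : ∀ {R M B} → FinitelyLearns R M B → ∀ {n e i j T T′} → IsTextFor (B j) T′ →
  initSeg T n ≡ initSeg T′ n → M (initSeg T n) ≡ just e → Hyp R e ≐ B i → B i ≐ B j
FinitelyLearns-unique {M = M} learns {n} {e} {j = j} {T′ = T′} text same out hyp
  with learns j T′ text
... | n′ , e′ , silent , stable , hyp′ with trans (sym out) (trans (cong M same) (stable n n′≤n))
  where
  n′≤n : n′ ≤ n
  n′≤n = ≮⇒≥ λ n<n′ → case trans (sym out) (trans (cong M same) (silent n n<n′)) of λ ()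
... | refl = λ x → (λ b → proj₁ (hyp′ x) (proj₂ (hyp x) b)) , (λ b → proj₁ (hyp x) (proj₂ (hyp′ x) b))

-- There are `suc (2 ^ n)` indices `0, …, 2 ^ n` but only `2 ^ n` subsets of the numbers below `n`.
collision : ExcludedMiddle 0ℓ → (S : ℕ → ℕ → Set) → ∀ n →
            ∃ λ i → ∃ λ j → i ≢ j × i ≤ 2 ^ n × (∀ c → c < n → S i c → S j c)
collision em S n =
  let i , j , i<j , eq = pigeonhole (≤-refl {suc (2 ^ n)}) (λ i → funToFin (trace (toℕ i)))
      same = λ c → trans (sym (finToFun-funToFin (trace (toℕ i)) c))
               (trans (cong (λ u → finToFun u c) eq) (finToFun-funToFin (trace (toℕ j)) c))
  in toℕ i , toℕ j , <⇒≢ i<j , s≤s⁻¹ (toℕ<n i) , λ c c<n sic →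
     subst (S (toℕ j)) (toℕ-fromℕ< c<n) (transfer (toℕ i) (toℕ j) (fromℕ< c<n) (same (fromℕ< c<n))
       (subst (S (toℕ i)) (sym (toℕ-fromℕ< c<n)) sic))
  where
  trace : ℕ → Fin n → Fin 2
  trace i c with em {S i (toℕ c)}
  ... | yes _ = fsuc fzero
  ... | no  _ = fzero
  transfer : ∀ i j c → trace i c ≡ trace j c → S i (toℕ c) → S j (toℕ c)
  transfer i j c eq sic with em {S i (toℕ c)} | em {S j (toℕ c)} | eq
  ... | _     | yes sjc | _  = sjc
  ... | yes _ | no  _   | ()
  ... | no ¬s | no  _   | _  = contradiction sic ¬s

module NoFiniteLearner (em : ExcludedMiddle 0ℓ) (Z : ℕ → Set) (a : ℕ → ℕ) (dense : DenseSimple Z a) (0∉Z : ¬ Z 0)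
  (B : ℕ → ℕ → Set) (family : IsFamily (zeta a) B)
  (M : List (Maybe ℕ) → Maybe ℕ) (recursiveM : RecursiveLearner M) (learns : FinitelyLearns (zeta a) M B) where
  open Classes em Z a (proj₁ dense) (proj₁ (proj₂ dense)) 0∉Z hiding (B; family)

  bCode : Code
  bCode = decode (proj₁ (proj₁ (proj₂ family)))

  B-run : ∀ {k x} → B k x → ∃ λ s → ∃ λ v → run bCode s (pair k x) ≡ suc v
  B-run {k} {x} b =
    let v , E = proj₁ (proj₂ (proj₁ (proj₂ family)) (pair k x)) (subst₂ B (sym (π₁-pair k x)) (sym (π₂-pair k x)) b)
        s , eq = run-complete bCode E
    in s , v , eq

  run-B : ∀ {k x s v} → run bCode s (pair k x) ≡ suc v → B k x
  run-B {k} {x} eq = subst₂ B (π₁-pair k x) (π₂-pair k x)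
    (proj₂ (proj₂ (proj₁ (proj₂ family)) (pair k x)) (_ , run-sound bCode eq))

  -- Dovetailing: position `t` tries the number `π₁ t` with search bound `π₂ t`. A datum at position
  -- `t` is thus at most `t`.
  entry : ℕ → ℕ → ℕ
  entry k t = natCase (run bCode (π₂ t) (pair k (π₁ t))) 0 (λ _ → suc (π₁ t))

  text : ℕ → Text
  text k t = decodeM (entry k t)

  textᶜ : Computable₂ (λ k t → codeM (text k t))
  textᶜ = ext (λ w → sym (codeM-decodeM (entry (π₁ w) (π₂ w))))
    (natCaseᶜ {s = λ w _ → suc (π₁ (π₂ w))}
      (ap₂ {k = run bCode} (runᶜ bCode) (π₂ᶜ ∘ᶜ π₂ᶜ) (pairᶜ π₁ᶜ (π₁ᶜ ∘ᶜ π₂ᶜ)))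
      (constᶜ 0) (sucᶜ (π₁ᶜ ∘ᶜ π₂ᶜ ∘ᶜ π₁ᶜ)))

  text-∈ : ∀ k t {x} → text k t ≡ just x → B k x × x ≡ π₁ t
  text-∈ k t eq with run bCode (π₂ t) (pair k (π₁ t)) in r
  text-∈ k t refl | suc v = run-B r , refl

  isText : ∀ k → IsTextFor (B k) (text k)
  isText k x = to , λ (t , eq) → proj₁ (text-∈ k t eq)
    where
    to : B k x → x ∈ᵀ text k
    to b with B-run b
    ... | s , v , eq = pair x s , cong decodeM (trans
      (cong₂ (λ x s → natCase (run bCode s (pair k x)) 0 (λ _ → suc x)) (π₁-pair x s) (π₂-pair x s))
      (natCase-intro {f = λ _ → suc x} eq refl))

  π₁≤ : ∀ t → π₁ t ≤ t
  π₁≤ t = subst (π₁ t ≤_) (pair-π t) (m≤pair (π₁ t) (π₂ t))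

  time : ℕ → ℕ
  time k = proj₁ (learns k (text k) (isText k))

  response : ℕ → ℕ → ℕ
  response k n = codeM (M (initSeg (text k) n))

  responseᶜ : Computable₂ response
  responseᶜ = mkC (Comp (decode (proj₁ recursiveM)) (code segᶜ)) λ w →
    ev-Comp (eval segᶜ w) (subst (λ z → φ (proj₁ recursiveM) z (response (π₁ w) (π₂ w)))
      (sym (initSegCode≡ (text (π₁ w)) (π₂ w))) (proj₂ recursiveM (initSeg (text (π₁ w)) (π₂ w))))
    where
    segᶜ = initSegCodeᶜ {v = λ k t → codeM (text k t)} textᶜ

  -- The learner is silent before `time k` and answers there, so an unbounded search for the first
  -- answer finds it.
  timeᶜ : Computable time
  timeᶜ = minᶜ {t = λ k n → natCase (response k n) 1 (λ _ → 0)}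
    (natCaseᶜ {s = λ _ _ → 0} responseᶜ (constᶜ 1) (constᶜ 0)) first
    where
    first : ∀ k → FirstZero (λ n → natCase (response k n) 1 (λ _ → 0)) (time k)
    first k with learns k (text k) (isText k)
    ... | n , e , silent , stable , _ =
      cong (λ o → natCase (codeM o) 1 (λ _ → 0)) (stable n ≤-refl) ,
      λ m m<n → 0 , cong (λ o → natCase (codeM o) 1 (λ _ → 0)) (silent m m<n)

  totalTime : ℕ → ℕ
  totalTime = primRec 0 (λ i r → r + time i)

  time≤total : ∀ {i n} → i < n → time i ≤ totalTime n
  time≤total {i} {suc n} i<1+n with m≤n⇒m<n∨m≡n (s≤s⁻¹ i<1+n)
  ... | inj₁ i<n  = ≤-trans (time≤total i<n) (m≤m+n _ (time n))
  ... | inj₂ refl = m≤n+m (time n) (totalTime n)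

  2^ᶜ : Computable (2 ^_)
  2^ᶜ = ext eq (primRecᶜ {s = λ _ _ r → r + r} (constᶜ 1) (π₂ᶜ ∘ᶜ π₂ᶜ +ᶜ π₂ᶜ ∘ᶜ π₂ᶜ) idᶜ)
    where
    eq : ∀ n → primRec 1 (λ _ r → r + r) n ≡ 2 ^ n
    eq zero    = refl
    eq (suc n) = cong₂ _+_ (eq n) (trans (eq n) (sym (+-identityʳ (2 ^ n))))

  -- The summand for index `2 ^ n` is included, because `collision` draws on `suc (2 ^ n)` indices.
  bound : ℕ → ℕ
  bound n = totalTime (suc (2 ^ n))

  boundᶜ : Computable bound
  boundᶜ = primRecᶜ {s = λ _ i r → r + time i} (constᶜ 0) (π₂ᶜ ∘ᶜ π₂ᶜ +ᶜ timeᶜ ∘ᶜ π₁ᶜ ∘ᶜ π₂ᶜ) (sucᶜ 2^ᶜ)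

  sparse : ∃ λ N → bound N < a N
  sparse = let N , f<a = proj₂ (proj₂ dense) bound (recursive boundᶜ) in N , f<a N ≤-refl

  Sees : ℕ → ℕ → Set
  Sees i c = ∃ λ t → ∃ λ x → t < time i × text i t ≡ just x × cls x ≡ c

  -- Data are bounded by their positions, so those used for `B i` lie below `a n`, in the first `n`
  -- classes. Each such class also holds a datum of `B j`, and `B j` is closed.
  seen⊆ : ∀ i j n → i ≤ 2 ^ n → bound n < a n → (∀ c → c < n → Sees i c → Sees j c) →
          ∀ t x → t < time i → text i t ≡ just x → B j x
  seen⊆ i j n i≤ sparse sees t x t<time eq =
    let t′ , y , _ , eq′ , cls-y = sees (cls x) (a-cancel-< (≤-<-trans (proj₁ (a-cls x)) x<a))
                                 (t , x , t<time , eq , refl)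
    in proj₁ family j y x (cls≡⇒zeta cls-y) (proj₁ (text-∈ j t′ eq′))
    where
    x<a : x < a n
    x<a = ≤-<-trans (subst (_≤ t) (sym (proj₂ (text-∈ i t eq))) (π₁≤ t))
            (<-trans (<-≤-trans t<time (time≤total {i} {suc (2 ^ n)} (s≤s i≤))) sparse)

  -- Prefixing the data that settle `B i` to a text for `B j` leaves a text for `B j`, on which the
  -- learner has already committed itself.
  seen⊆⇒≐ : ∀ i j → (∀ t x → t < time i → text i t ≡ just x → B j x) → B i ≐ B j
  seen⊆⇒≐ i j sub =
    let n , e , _ , stable , hyp = learns i (text i) (isText i) in
    FinitelyLearns-unique {M = M} {B} learns {n} {e} {i} {j} {text i} {splice n (text i) (text j)}
      (splice-text n (text i) (text j) (isText j) sub)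
      (initSeg-cong n λ t t<n → sym (splice-< n (text i) (text j) t<n))
      (stable n ≤-refl) hyp

  sparse⇒⊥ : ∀ n → bound n < a n → ⊥
  sparse⇒⊥ n bound<a = go (collision em Sees n)
    where
    go : (∃ λ i → ∃ λ j → i ≢ j × i ≤ 2 ^ n × (∀ c → c < n → Sees i c → Sees j c)) → ⊥
    go (i , j , i≢j , i≤ , sees) = proj₂ (proj₂ family) i j i≢j (seen⊆⇒≐ i j (seen⊆ i j n i≤ bound<a sees))

  absurd : ⊥
  absurd = sparse⇒⊥ (proj₁ sparse) (proj₂ sparse)

theorem10 : ExcludedMiddle 0ℓ →
    (Z : ℕ → Set) (a : ℕ → ℕ) → DenseSimple Z a → ¬ Z 0 →
    PositiveEquivalence (zeta a) ×
    (∃ λ (B : ℕ → ℕ → Set) → IsFamily (zeta a) B ×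
    ∃ λ (M : List (Maybe ℕ) → Maybe ℕ) → RecursiveLearner M × ConfidentlyLearns (zeta a) M B) ×
    (∀ (B : ℕ → ℕ → Set) → IsFamily (zeta a) B →
    ¬ (∃ λ (M : List (Maybe ℕ) → Maybe ℕ) → RecursiveLearner M × FinitelyLearns (zeta a) M B))
theorem10 em Z a dense@(reZ , enum , _) 0∉Z =
  positive , (B , family , M , M-recursive , confident) ,
  λ B family (M , recursiveM , learns) → NoFiniteLearner.absurd em Z a dense 0∉Z B family M recursiveM learns
  where
  open Classes em Z a reZ enum 0∉Z
  open ConfidentLearner em Z a reZ enum 0∉Z
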